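{- Let $\mathcal{F}$ be a periodic infinite frieze of positive integers that is realisable in an annulus but not in a punctured disc, and let $(s_k)_{k\ge0}$ be its growth coefficients. Then $s_k>2$ for all $k>0$.
   Context: An infinite frieze of positive integers is an array $(m_{i,j})$, indexed by $i\in\mathbb{Z}$ and $j\ge i-2$, with $m_{i,i-2}=0$, $m_{i,i-1}=1$, with $m_{i,j}$ a positive integer for $j\ge i-1$, and with $m_{i,j}m_{i+1,j+1}-m_{i,j+1}m_{i+1,j}=1$ for all $i$ and all $j\ge i-1$. It is periodic if for some $n\ge1$ one has $m_{i+n,j+n}=m_{i,j}$ for all entries. With $n$ the minimal such period, the growth coefficients are $s_0:=2$ and $s_k:=m_{1,kn}-m_{2,kn-1}$ for $k\ge1$. The quiddity row is $a_i=m_{i,i}$; a finite block of consecutive entries whose periodic repetition is the quiddity row is called a quiddity sequence of the frieze (its length is a period, not necessarily minimal). Triangulations: consider either an annulus with at least one marked point on each boundary component, or a once-punctured disc with at least one marked point on its boundary (the puncture also being allowed as an endpoint of arcs). A triangulation is a maximal collection of pairwise non-crossing (non-self-crossing) arcs, up to isotopy, with endpoints at marked points (or the puncture), none contractible or isotopic to a boundary segment; loops are allowed. For a chosen boundary component with marked points $1,\dots,N$ in cyclic order it gives the sequence $(a_1,\dots,a_N)$, where $a_i$ is the number of regions incident with the marked point $i$, counted in a small neighbourhood of it (i.e. one plus the number of ends of arcs at $i$). A periodic infinite frieze of positive integers is realisable in an annulus (respectively in a punctured disc) if it has a quiddity sequence obtained in this way from a triangulation of an annulus (respectively of a punctured disc).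 -}

module Defs where

open import Data.Fin using (Fin; toℕ)
open import Data.Integer using (ℤ; +_; 0ℤ; 1ℤ; _+_; _-_; _*_; _≤_; _<_)
open import Data.Integer.Divisibility.Signed using (_∣?_)
open import Data.List using (List; []; _∷_; length; filter; concatMap)
open import Data.List.Relation.Unary.All using (All)
open import Data.List.Relation.Unary.AllPairs using (AllPairs)
open import Data.List.Relation.Unary.Any using (Any)
open import Data.Nat as ℕ using (ℕ; zero; suc)
open import Data.Product using (Σ-syntax; ∃-syntax; _×_)
open import Data.Sum using (_⊎_)
open import Data.Unit using (⊤)
open import Data.Empty using (⊥)
open import Relation.Binary.PropositionalEquality using (_≡_)
open import Relation.Nullary using (¬_)

-- The array (m i j) is indexed by j ≥ i - 2.  The values of the total function
-- m at j < i - 2 are junk, and nothing below constrains or uses them.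
record InfiniteFrieze : Set where
  field
    m        : ℤ → ℤ → ℤ
    zeros    : ∀ i → m i (i - + 2) ≡ 0ℤ
    ones     : ∀ i → m i (i - 1ℤ) ≡ 1ℤ
    positive : ∀ i j → i - 1ℤ ≤ j → 0ℤ < m i j
    diamond  : ∀ i j → i - 1ℤ ≤ j →
               m i j * m (i + 1ℤ) (j + 1ℤ) - m i (j + 1ℤ) * m (i + 1ℤ) j ≡ 1ℤ

module _ (F : InfiniteFrieze) where
  open InfiniteFrieze F

  HasPeriod : ℕ → Set
  HasPeriod n = ∀ i j → i - + 2 ≤ j → m (i + + n) (j + + n) ≡ m i j

  -- F is periodic, and n is its least positive period.
  IsMinimalPeriod : ℕ → Set
  IsMinimalPeriod n =
    1 ℕ.≤ n × HasPeriod n × (∀ n′ → 1 ℕ.≤ n′ → HasPeriod n′ → n ℕ.≤ n′)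

  -- The k-th growth coefficient when n is the minimal period of F.
  growth : (n k : ℕ) → ℤ
  growth n zero      = + 2
  growth n k@(suc _) = m 1ℤ (+ (k ℕ.* n)) - m (+ 2) (+ (k ℕ.* n) - 1ℤ)

  -- The block q is found in the quiddity row starting at position c, and the
  -- whole row is the periodic repetition of this block.
  IsQuidditySequence : ∀ {N} → (Fin N → ℕ) → Set
  IsQuidditySequence {N} q =
    1 ℕ.≤ N ×
    (∃[ c ] ∀ (t : ℤ) (k : Fin N) →
       let i = c + + toℕ k + t * + N in m i i ≡ + q k)

-- Arcs up to isotopy on a surface with marked points, represented by their
-- lifts to a simply connected cover (the universal cover of the annulus, or of
-- the disc minus its puncture) whose deck group is ℤ.  On every boundary
-- component b the lifted marked points are labelled consecutively by ℤ, and the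
-- generator of the deck group adds marked b to these labels.
--
-- In the cover an arc is determined up to isotopy by its endpoints, so a lift
-- is just the data of these endpoints.  Two isotopy classes can be drawn
-- without crossing iff no lift of one has endpoints which separate those of a
-- lift of the other; taking both classes equal gives self-crossing.
record MarkedSurface : Set₁ where
  field
    Boundary  : Set
    marked    : Boundary → ℕ
    Lift      : Set
    translate : ℤ → Lift → Lift
    -- neither contractible nor isotopic to a boundary segment
    Essential : Lift → Set
    -- the endpoints of the two lifts separate each other
    Separates : Lift → Lift → Set
    -- the labels of the endpoints lying over the given boundary component
    ends      : Boundary → Lift → List ℤ

module _ (S : MarkedSurface) where
  open MarkedSurface S

  Isotopic : Lift → Lift → Set
  Isotopic α β = ∃[ t ] translate t α ≡ β

  Crosses : Lift → Lift → Set
  Crosses α β = ∃[ t ] Separates (translate t α) β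

  IsArc : Lift → Set
  IsArc α = Essential α × ¬ Crosses α α

  -- The list holds one lift of each arc of the collection.
  record Triangulation : Set where
    field
      arcs        : List Lift
      areArcs     : All IsArc arcs
      distinct    : AllPairs (λ α β → ¬ Isotopic α β) arcs
      noncrossing : AllPairs (λ α β → ¬ Crosses α β) arcs
      maximal     : ∀ α → IsArc α → All (λ β → ¬ Crosses α β) arcs →
                    Any (Isotopic α) arcs

  -- An end of an arc lies at the marked point labelled v iff its label in a
  -- lift is congruent to v; a loop has two ends at its base point.
  regionsAt : Triangulation → (b : Boundary) → ℤ → ℕ
  regionsAt T b v =
    1 ℕ.+ length (filter (λ x → + marked b ∣? (x - v)) (concatMap (ends b) arcs))
    where open Triangulation T

  sequence : Triangulation → (b : Boundary) → Fin (marked b) → ℕ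
  sequence T b k = regionsAt T b (+ toℕ k)

  RealisableIn : InfiniteFrieze → Set
  RealisableIn F =
    Σ[ T ∈ Triangulation ] Σ[ b ∈ Boundary ] IsQuidditySequence F (sequence T b)

-- i < k < j < l or k < i < l < j
Interleaved : (i j k l : ℤ) → Set
Interleaved i j k l = (i < k × k < j × j < l) ⊎ (k < i × i < l × l < j)

data Side : Set where
  outer inner : Side

-- The universal cover of the annulus is a strip whose two boundary lines are
-- both labelled from left to right.  peripheral s i j joins the points i and j
-- of the line s; as arcs are unoriented, the left endpoint i is listed first,
-- and Essential discards i = j (contractible), i + 1 = j (boundary segment) and
-- the redundant i > j.  bridging i j joins the outer point i to the inner
-- point j.
data AnnulusLift : Set where
  peripheral : Side → ℤ → ℤ → AnnulusLift
  bridging   : ℤ → ℤ → AnnulusLift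

endpointOn : Side → (i j : ℤ) → ℤ
endpointOn outer i j = i
endpointOn inner i j = j

annulus : (Side → ℕ) → MarkedSurface
annulus N = record
  { Boundary  = Side
  ; marked    = N
  ; Lift      = AnnulusLift
  ; translate = translate
  ; Essential = Essential
  ; Separates = Separates
  ; ends      = ends
  }
  where
  translate : ℤ → AnnulusLift → AnnulusLift
  translate t (peripheral s i j) = peripheral s (i + t * + N s) (j + t * + N s)
  translate t (bridging i j)     = bridging (i + t * + N outer) (j + t * + N inner)

  Essential : AnnulusLift → Set
  Essential (peripheral s i j) = i + 1ℤ < j
  Essential (bridging i j)     = ⊤

  Separates : AnnulusLift → AnnulusLift → Set
  Separates (peripheral s i j) (peripheral s′ k l) = s ≡ s′ × Interleaved i j k l
  Separates (peripheral s i j) (bridging k l)      =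
    i < endpointOn s k l × endpointOn s k l < j
  Separates (bridging k l)     (peripheral s i j)  =
    i < endpointOn s k l × endpointOn s k l < j
  Separates (bridging i j)     (bridging k l)      =
    (i < k × l < j) ⊎ (k < i × j < l)

  ends : Side → AnnulusLift → List ℤ
  ends outer (peripheral outer i j) = i ∷ j ∷ []
  ends inner (peripheral inner i j) = i ∷ j ∷ []
  ends outer (peripheral inner i j) = []
  ends inner (peripheral outer i j) = []
  ends s     (bridging i j)         = endpointOn s i j ∷ []

-- The universal cover of the disc minus its puncture is a half-plane with the
-- puncture at infinity.  chord i j joins the boundary points i and j, under the
-- same convention as peripheral; spoke i joins the boundary point i to the
-- puncture.  A simple loop based at the puncture is contractible, so there is
-- no further kind of arc.
data DiscLift : Set where
  chord : ℤ → ℤ → DiscLift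
  spoke : ℤ → DiscLift

puncturedDisc : ℕ → MarkedSurface
puncturedDisc N = record
  { Boundary  = ⊤
  ; marked    = λ _ → N
  ; Lift      = DiscLift
  ; translate = translate
  ; Essential = Essential
  ; Separates = Separates
  ; ends      = λ _ → ends
  }
  where
  translate : ℤ → DiscLift → DiscLift
  translate t (chord i j) = chord (i + t * + N) (j + t * + N)
  translate t (spoke i)   = spoke (i + t * + N)

  Essential : DiscLift → Set
  Essential (chord i j) = i + 1ℤ < j
  Essential (spoke i)   = ⊤

  Separates : DiscLift → DiscLift → Set
  Separates (chord i j) (chord k l) = Interleaved i j k l
  Separates (chord i j) (spoke k)   = i < k × k < j
  Separates (spoke k)   (chord i j) = i < k × k < j
  Separates (spoke i)   (spoke k)   = ⊥

  ends : DiscLift → List ℤ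
  ends (chord i j) = i ∷ j ∷ []
  ends (spoke i)   = i ∷ []

RealisableInAnnulus : InfiniteFrieze → Set
RealisableInAnnulus F =
  Σ[ N ∈ (Side → ℕ) ] (∀ s → 1 ℕ.≤ N s) × RealisableIn (annulus N) F

RealisableInPuncturedDisc : InfiniteFrieze → Set
RealisableInPuncturedDisc F =
  Σ[ N ∈ ℕ ] 1 ℕ.≤ N × RealisableIn (puncturedDisc N) F

{-# OPTIONS --safe #-}
module Submission where

-- Let N = k n and let w be the block of quiddity entries a₁, …, a_N.  The k-th
-- growth coefficient is the trace of the product of the matrices
-- [[a, -1], [1, 0]] over w, and F supplies a positive solution of
-- y_{j-1} + y_{j+1} = a_j y_j along the repetitions of w.  Removing an entry 1
-- from the cyclic word w and lowering its neighbours by one (cutting an ear)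
-- preserves the trace and the existence of a positive solution, and a
-- triangulation of the punctured disc for the shorter word extends to one for w
-- by gluing the ear back.  A word without entries 1 either consists of 2s, and is
-- then realised by the triangulation of the disc by spokes, or has trace
-- above 2.

open import Defs
open import Data.Empty using (⊥-elim)
open import Data.Fin using (toℕ)
open import Data.Integer as ℤ
  using (ℤ; +_; 0ℤ; 1ℤ; -1ℤ; _+_; _-_; -_; _*_; _≤_; _<_; _/ℕ_; _%ℕ_)
open import Data.Integer.DivMod using (a≡a%ℕn+[a/ℕn]*n; n%ℕd<d)
open import Data.Integer.Divisibility.Signed using (_∣_; divides; _∣?_)
import Data.Integer.Properties as ℤₚ
open import Data.Integer.Tactic.RingSolver using (solve-∀)
open import Data.List
  using (List; []; _∷_; _++_; _∷ʳ_; length; filter; map; concatMap; foldr; applyUpTo;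
         InitLast; initLast; _∷ʳ′_)
open import Data.List.Properties
  using (filter-accept; filter-reject; filter-none; filter-≐; applyUpTo-∷ʳ; length-applyUpTo;
         ++-assoc; ++-identityʳ; ∷ʳ-injective; ∷-injective; length-++; length-++-comm)
open import Data.List.Relation.Unary.All as All using (All; []; _∷_)
import Data.List.Relation.Unary.All.Properties as All
open import Data.List.Relation.Unary.AllPairs as AllPairs using (AllPairs; []; _∷_)
import Data.List.Relation.Unary.AllPairs.Properties as AllPairs
open import Data.List.Relation.Unary.Any as Any using (Any; here; there)
import Data.List.Relation.Unary.Any.Properties as Any
open import Data.Nat as ℕ using (ℕ; zero; suc; s≤s; z≤n)
import Data.Nat.Properties as ℕₚ
import Data.Nat.Tactic.RingSolver as ℕ-RingSolver
open import Data.Product using (Σ-syntax; _×_; _,_; proj₁; proj₂)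
open import Data.Sum using (_⊎_; inj₁; inj₂)
open import Data.Unit using (tt)
open import Function using (_∘_; case_of_)
open import Relation.Binary using (tri<; tri≈; tri>)
open import Relation.Binary.PropositionalEquality
open import Relation.Nullary using (¬_; yes; no)
open import Relation.Unary using (Pred; Decidable)

-- Monodromy matrices

-- At an entry 1 the recurrence reads `y + x ≡ z`. Deleting the middle term `z` and subtracting from
-- the two neighbouring equations leaves a positive solution for the cut word. So the induction runs
-- over words carrying a positive solution, and no frieze has to be built for a cut word. Positivity
-- keeps every entry at least 1 after a cut and excludes the word `1`, whose only entry has no
-- neighbours to lower.
--
-- The solution is a row of `F`. Its coefficients are periodic, but the row itself need not be, so a
-- solution is recorded over infinitely many periods and not as a cyclic object.
--
-- A quiddity sequence may have any period as its length. A triangulation of the disc with `k n`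
-- marked points, realising `k` periods at once, therefore contradicts non-realisability for each
-- `k > 0` separately, and no relation between different growth coefficients enters.

record Matrix : Set where
  constructor mat
  field
    a b c d : ℤ

infixl 7 _⊗_
_⊗_ : Matrix → Matrix → Matrix
mat a b c d ⊗ mat a′ b′ c′ d′ =
  mat (a * a′ + b * c′) (a * b′ + b * d′) (c * a′ + d * c′) (c * b′ + d * d′)

identity : Matrix
identity = mat 1ℤ 0ℤ 0ℤ 1ℤ

trace : Matrix → ℤ
trace (mat a b c d) = a + d

mat-cong : ∀ {a a′ b b′ c c′ d d′} → a ≡ a′ → b ≡ b′ → c ≡ c′ → d ≡ d′ →
           mat a b c d ≡ mat a′ b′ c′ d′
mat-cong refl refl refl refl = refl

⊗-assoc : ∀ P Q R → (P ⊗ Q) ⊗ R ≡ P ⊗ (Q ⊗ R)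
⊗-assoc (mat a b c d) (mat e f g h) (mat i j k l) =
  mat-cong (entry a b e f g h i k) (entry a b e f g h j l)
           (entry c d e f g h i k) (entry c d e f g h j l)
  where
  entry : ∀ a b e f g h i k →
          (a * e + b * g) * i + (a * f + b * h) * k ≡
          a * (e * i + f * k) + b * (g * i + h * k)
  entry = solve-∀

⊗-identityˡ : ∀ P → identity ⊗ P ≡ P
⊗-identityˡ (mat a b c d) = mat-cong (top a c) (top b d) (bottom a c) (bottom b d)
  where
  top : ∀ x y → 1ℤ * x + 0ℤ * y ≡ x
  top = solve-∀
  bottom : ∀ x y → 0ℤ * x + 1ℤ * y ≡ y
  bottom = solve-∀

trace-comm : ∀ P Q → trace (P ⊗ Q) ≡ trace (Q ⊗ P)
trace-comm (mat a b c d) (mat e f g h) = lemma a b c d e f g h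
  where
  lemma : ∀ a b c d e f g h →
          a * e + b * g + (c * f + d * h) ≡ e * a + f * c + (g * b + h * d)
  lemma = solve-∀

step : ℕ → Matrix
step x = mat (+ x) -1ℤ 1ℤ 0ℤ

monodromy : List ℕ → Matrix
monodromy = foldr (λ x P → step x ⊗ P) identity

monodromy-++ : ∀ u v → monodromy (u ++ v) ≡ monodromy u ⊗ monodromy v
monodromy-++ []      v = sym (⊗-identityˡ _)
monodromy-++ (x ∷ u) v =
  trans (cong (step x ⊗_) (monodromy-++ u v)) (sym (⊗-assoc (step x) _ _))

trace-rotate : ∀ u v → trace (monodromy (u ++ v)) ≡ trace (monodromy (v ++ u))
trace-rotate u v = begin
  trace (monodromy (u ++ v))           ≡⟨ cong trace (monodromy-++ u v) ⟩
  trace (monodromy u ⊗ monodromy v)    ≡⟨ trace-comm (monodromy u) _ ⟩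
  trace (monodromy v ⊗ monodromy u)    ≡⟨ cong trace (monodromy-++ v u) ⟨
  trace (monodromy (v ++ u))           ∎
  where open ≡-Reasoning

monodromy-suc-head : ∀ x w →
  monodromy (suc x ∷ w) ≡ mat 1ℤ 1ℤ 0ℤ 1ℤ ⊗ monodromy (x ∷ w)
monodromy-suc-head x w with monodromy w
... | mat a b c d = mat-cong (e₁ (+ x) a c) (e₁ (+ x) b d) (e₂ (+ x) a c) (e₂ (+ x) b d)
  where
  e₁ : ∀ x a c → (1ℤ + x) * a + -1ℤ * c ≡ 1ℤ * (x * a + -1ℤ * c) + 1ℤ * (1ℤ * a + 0ℤ * c)
  e₁ = solve-∀
  e₂ : ∀ x a c → 1ℤ * a + 0ℤ * c ≡ 0ℤ * (x * a + -1ℤ * c) + 1ℤ * (1ℤ * a + 0ℤ * c)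
  e₂ = solve-∀

monodromy-suc-last : ∀ w x →
  monodromy (w ∷ʳ suc x) ≡ monodromy (w ∷ʳ x) ⊗ mat 1ℤ 0ℤ -1ℤ 1ℤ
monodromy-suc-last [] x =
  mat-cong (e₁ (+ x)) (e₂ (+ x)) refl refl
  where
  e₁ : ∀ x → (1ℤ + x) * 1ℤ + -1ℤ * 0ℤ ≡
             (x * 1ℤ + -1ℤ * 0ℤ) * 1ℤ + (x * 0ℤ + -1ℤ * 1ℤ) * -1ℤ
  e₁ = solve-∀
  e₂ : ∀ x → (1ℤ + x) * 0ℤ + -1ℤ * 1ℤ ≡
             (x * 1ℤ + -1ℤ * 0ℤ) * 0ℤ + (x * 0ℤ + -1ℤ * 1ℤ) * 1ℤ
  e₂ = solve-∀
monodromy-suc-last (y ∷ w) x =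
  trans (cong (step y ⊗_) (monodromy-suc-last w x)) (sym (⊗-assoc (step y) _ _))

-- Raising the last entry multiplies by `L = mat 1 0 -1 1` on the right, raising the first by
-- `U = mat 1 1 0 1` on the left, and `L ⊗ step 1 ⊗ U` is the identity; cyclicity of the trace does
-- the rest, here checked by expansion in `cancel`. The hypothesis reads the half-lowered word from
-- both ends, which also covers an ear whose two neighbours are the same entry.
trace-cut : ∀ {u e b w} → u ∷ʳ e ≡ suc b ∷ w →
            trace (monodromy (1 ∷ u ∷ʳ suc e)) ≡ trace (monodromy (b ∷ w))
trace-cut {u} {e} {b} {w} eq = begin
  trace (step 1 ⊗ monodromy (u ∷ʳ suc e))
    ≡⟨ cong (λ P → trace (step 1 ⊗ P)) (monodromy-suc-last u e) ⟩
  trace (step 1 ⊗ (monodromy (u ∷ʳ e) ⊗ mat 1ℤ 0ℤ -1ℤ 1ℤ))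
    ≡⟨ cong (λ v → trace (step 1 ⊗ (monodromy v ⊗ mat 1ℤ 0ℤ -1ℤ 1ℤ))) eq ⟩
  trace (step 1 ⊗ (monodromy (suc b ∷ w) ⊗ mat 1ℤ 0ℤ -1ℤ 1ℤ))
    ≡⟨ cong (λ P → trace (step 1 ⊗ (P ⊗ mat 1ℤ 0ℤ -1ℤ 1ℤ))) (monodromy-suc-head b w) ⟩
  trace (step 1 ⊗ (mat 1ℤ 1ℤ 0ℤ 1ℤ ⊗ monodromy (b ∷ w) ⊗ mat 1ℤ 0ℤ -1ℤ 1ℤ))
    ≡⟨ cancel (monodromy (b ∷ w)) ⟩
  trace (monodromy (b ∷ w)) ∎
  where
  open ≡-Reasoning
  lemma : ∀ a b c d →
    1ℤ * ((1ℤ * a + 1ℤ * c) * 1ℤ + (1ℤ * b + 1ℤ * d) * -1ℤ) +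
    -1ℤ * ((0ℤ * a + 1ℤ * c) * 1ℤ + (0ℤ * b + 1ℤ * d) * -1ℤ) +
    (1ℤ * ((1ℤ * a + 1ℤ * c) * 0ℤ + (1ℤ * b + 1ℤ * d) * 1ℤ) +
     0ℤ * ((0ℤ * a + 1ℤ * c) * 0ℤ + (0ℤ * b + 1ℤ * d) * 1ℤ)) ≡ a + d
  lemma = solve-∀
  cancel : ∀ P → trace (step 1 ⊗ (mat 1ℤ 1ℤ 0ℤ 1ℤ ⊗ P ⊗ mat 1ℤ 0ℤ -1ℤ 1ℤ)) ≡ trace P
  cancel (mat a b c d) = lemma a b c d

-- For entries at least 2 the four parameters stay nonnegative under left
-- multiplication by a step, and the trace is 2 + α + β.
shape : (α β γ δ : ℤ) → Matrix
shape α β γ δ = mat (1ℤ + δ) (β + γ - δ) (δ - α) (1ℤ + β + α - δ)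

step-shape : ∀ k α β γ δ →
  mat (1ℤ + (1ℤ + k)) -1ℤ 1ℤ 0ℤ ⊗ shape α β γ δ ≡
  shape (α + k * (1ℤ + δ)) (β + γ) (γ + k * (1ℤ + β + γ)) (1ℤ + δ + α + k * (1ℤ + δ))
step-shape k α β γ δ =
  mat-cong (e₁ k α β γ δ) (e₂ k α β γ δ) (e₃ k α β γ δ) (e₄ k α β γ δ)
  where
  e₁ : ∀ k α β γ δ → (1ℤ + (1ℤ + k)) * (1ℤ + δ) + -1ℤ * (δ + - α) ≡
       1ℤ + (1ℤ + δ + α + k * (1ℤ + δ))
  e₁ = solve-∀
  e₂ : ∀ k α β γ δ → (1ℤ + (1ℤ + k)) * (β + γ + - δ) + -1ℤ * (1ℤ + β + α + - δ) ≡
       β + γ + (γ + k * (1ℤ + β + γ)) + - (1ℤ + δ + α + k * (1ℤ + δ))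
  e₂ = solve-∀
  e₃ : ∀ k α β γ δ → 1ℤ * (1ℤ + δ) + 0ℤ * (δ + - α) ≡
       (1ℤ + δ + α + k * (1ℤ + δ)) + - (α + k * (1ℤ + δ))
  e₃ = solve-∀
  e₄ : ∀ k α β γ δ → 1ℤ * (β + γ + - δ) + 0ℤ * (1ℤ + β + α + - δ) ≡
       1ℤ + (β + γ) + (α + k * (1ℤ + δ)) + - (1ℤ + δ + α + k * (1ℤ + δ))
  e₄ = solve-∀

-- Words grow on the left. An entry `2 + k` adds `k * suc δ` to `α`, so `α` stays 0 along 2s,
-- becomes positive at the first larger entry and never decreases afterwards.
monodromy-shape : ∀ {w} → All (2 ℕ.≤_) w →
  Σ[ α ∈ ℕ ] Σ[ β ∈ ℕ ] Σ[ γ ∈ ℕ ] Σ[ δ ∈ ℕ ]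
    monodromy w ≡ shape (+ α) (+ β) (+ γ) (+ δ) × (All (_≡ 2) w ⊎ 0 ℕ.< α)
monodromy-shape [] = 0 , 0 , 0 , 0 , refl , inj₁ []
monodromy-shape {x ∷ w} (s≤s (s≤s (z≤n {k})) ∷ 2≤w)
  with monodromy-shape 2≤w
... | α , β , γ , δ , eq , twos =
  α ℕ.+ k ℕ.* suc δ , β ℕ.+ γ , γ ℕ.+ k ℕ.* suc (β ℕ.+ γ) , suc (δ ℕ.+ α ℕ.+ k ℕ.* suc δ) ,
  product , strict k twos
  where
  product : monodromy (suc (suc k) ∷ w) ≡
            shape (+ (α ℕ.+ k ℕ.* suc δ)) (+ (β ℕ.+ γ))
                  (+ (γ ℕ.+ k ℕ.* suc (β ℕ.+ γ))) (+ suc (δ ℕ.+ α ℕ.+ k ℕ.* suc δ))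
  product = begin
    step (suc (suc k)) ⊗ monodromy w
      ≡⟨ cong (step (suc (suc k)) ⊗_) eq ⟩
    step (suc (suc k)) ⊗ shape (+ α) (+ β) (+ γ) (+ δ)
      ≡⟨ step-shape (+ k) (+ α) (+ β) (+ γ) (+ δ) ⟩
    shape (+ α + + k * + suc δ) (+ (β ℕ.+ γ)) (+ γ + + k * + suc (β ℕ.+ γ))
          (+ suc (δ ℕ.+ α) + + k * + suc δ)
      ≡⟨ cong₂ (λ x y → shape (+ α + x) (+ (β ℕ.+ γ)) (+ γ + y) (+ suc (δ ℕ.+ α) + x))
               (ℤₚ.pos-* k (suc δ)) (ℤₚ.pos-* k (suc (β ℕ.+ γ))) ⟨
    shape (+ (α ℕ.+ k ℕ.* suc δ)) (+ (β ℕ.+ γ))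
          (+ (γ ℕ.+ k ℕ.* suc (β ℕ.+ γ))) (+ suc (δ ℕ.+ α ℕ.+ k ℕ.* suc δ)) ∎
    where open ≡-Reasoning

  strict : ∀ k → All (_≡ 2) w ⊎ 0 ℕ.< α →
           All (_≡ 2) (suc (suc k) ∷ w) ⊎ 0 ℕ.< α ℕ.+ k ℕ.* suc δ
  strict k       (inj₂ (s≤s _)) = inj₂ (s≤s z≤n)
  strict zero    (inj₁ w≡2)     = inj₁ (refl ∷ w≡2)
  strict (suc k) (inj₁ _)       = inj₂ (ℕₚ.<-≤-trans ℕ.z<s (ℕₚ.m≤n+m _ α))

twos-or-hyperbolic : ∀ {w} → All (2 ℕ.≤_) w →
                     All (_≡ 2) w ⊎ + 2 < trace (monodromy w)
twos-or-hyperbolic 2≤w with monodromy-shape 2≤w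
... | α , β , γ , δ , eq , inj₁ w≡2 = inj₁ w≡2
... | suc α , β , γ , δ , eq , inj₂ _ =
  inj₂ (subst (+ 2 <_) (sym (trans (cong trace eq) (trace-shape (+ suc α) (+ β) (+ γ) (+ δ))))
              (ℤ.+<+ (s≤s (s≤s (s≤s z≤n)))))
  where
  trace-shape : ∀ α β γ δ → 1ℤ + δ + (1ℤ + β + α + - δ) ≡ 1ℤ + (1ℤ + (α + β))
  trace-shape = solve-∀

-- Positive solutions of the recurrence

-- Run w y z y′ z′: the recurrence y + x = a z with coefficients a read from w
-- leads from the consecutive terms y, z to y′, z′, through positive terms.
data Run : List ℕ → (y z y′ z′ : ℕ) → Set where
  []   : ∀ {y z} → Run [] y z y z
  read : ∀ {a w y z x y′ z′} → 0 ℕ.< y → y ℕ.+ x ≡ a ℕ.* z →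
         Run w z x y′ z′ → Run (a ∷ w) y z y′ z′

Run-[]⁻ : ∀ {y z y′ z′} → Run [] y z y′ z′ → y ≡ y′ × z ≡ z′
Run-[]⁻ [] = refl , refl

Run-++⁺ : ∀ {u v y z y′ z′ y″ z″} →
          Run u y z y′ z′ → Run v y′ z′ y″ z″ → Run (u ++ v) y z y″ z″
Run-++⁺ []               r′ = r′
Run-++⁺ (read y>0 eq r) r′ = read y>0 eq (Run-++⁺ r r′)

Run-++⁻ : ∀ u {v y z y″ z″} → Run (u ++ v) y z y″ z″ →
          Σ[ y′ ∈ ℕ ] Σ[ z′ ∈ ℕ ] Run u y z y′ z′ × Run v y′ z′ y″ z″
Run-++⁻ []      r = _ , _ , [] , r
Run-++⁻ (_ ∷ u) (read y>0 eq r) with Run-++⁻ u r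
... | y′ , z′ , r₁ , r₂ = y′ , z′ , read y>0 eq r₁ , r₂

0≢positive-sum : ∀ {y x} → 0 ℕ.< y → y ℕ.+ x ≢ 0
0≢positive-sum {suc y} _ ()

-- An entry 0 would make the sum of a positive and a natural number vanish. This is how the solution
-- controls the word.
Run-positive : ∀ {w y z y′ z′} → Run w y z y′ z′ → All (1 ℕ.≤_) w
Run-positive []                      = []
Run-positive (read {zero} y>0 eq r)  = ⊥-elim (0≢positive-sum y>0 eq)
Run-positive (read {suc _} y>0 eq r) = s≤s z≤n ∷ Run-positive r

-- The term `y′ + x′` is the one at the ear. Deleting it makes `x′` the successor of `y′`, and
-- subtracting `y′` from the equation centred at `y′` lowers its coefficient by one.
Run-decrement-last : ∀ u {e y z y′ x′} → Run (u ∷ʳ suc e) y z y′ (y′ ℕ.+ x′) →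
                     Run (u ∷ʳ e) y z y′ x′
Run-decrement-last [] {e} {y} {z} {x′ = x′} (read y>0 eq []) =
  read y>0 (ℕₚ.+-cancelˡ-≡ z (y ℕ.+ x′) (e ℕ.* z) (trans (swap z y x′) eq)) []
  where
  swap : ∀ z y x → z ℕ.+ (y ℕ.+ x) ≡ y ℕ.+ (z ℕ.+ x)
  swap = ℕ-RingSolver.solve-∀
Run-decrement-last (_ ∷ u) (read y>0 eq r) = read y>0 eq (Run-decrement-last u r)

-- The mirror image: the deleted term is `y + z`, and `z` is subtracted from the equation centred at
-- `z`.
Run-decrement-head : ∀ {b w y z y′ z′} → 0 ℕ.< y →
                     Run (suc b ∷ w) (y ℕ.+ z) z y′ z′ → Run (b ∷ w) y z y′ z′
Run-decrement-head {b} {y = y} {z} y>0 (read {x = x} _ eq r) =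
  read y>0 (ℕₚ.+-cancelˡ-≡ z (y ℕ.+ x) (b ℕ.* z) (trans (swap z y x) eq)) r
  where
  swap : ∀ z y x → z ℕ.+ (y ℕ.+ x) ≡ y ℕ.+ z ℕ.+ x
  swap = ℕ-RingSolver.solve-∀

-- A positive solution over the periodic repetition of w, sampled at the starts
-- of the periods.
LongRun : List ℕ → Set
LongRun w = Σ[ y ∈ (ℕ → ℕ) ] Σ[ z ∈ (ℕ → ℕ) ]
            ∀ k → Run w (y k) (z k) (y (suc k)) (z (suc k))

-- A period of `v ++ u` ends inside the next period of `u ++ v`, so each new run is assembled from
-- two consecutive old ones.
LongRun-rotate : ∀ u v → LongRun (u ++ v) → LongRun (v ++ u)
LongRun-rotate u v (y , z , r) = y′ , z′ , r′
  where
  y′ z′ : ℕ → ℕ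
  y′ k = let y , _ , _ , _ = Run-++⁻ u (r k) in y
  z′ k = let _ , z , _ , _ = Run-++⁻ u (r k) in z
  r′ : ∀ k → Run (v ++ u) (y′ k) (z′ k) (y′ (suc k)) (z′ (suc k))
  r′ k = let _ , _ , _ , rᵛ = Run-++⁻ u (r k)
             _ , _ , rᵘ , _ = Run-++⁻ u (r (suc k)) in Run-++⁺ rᵛ rᵘ

-- Cutting off the ear 1 from the cyclic sequence 1 ∷ t lowers the last and the
-- first entry of t by one; these coincide when t has length one.
EarCut : List ℕ → Set
EarCut t =
  Σ[ u ∈ List ℕ ] Σ[ e ∈ ℕ ] Σ[ b ∈ ℕ ] Σ[ w ∈ List ℕ ]
    t ≡ u ∷ʳ suc e × u ∷ʳ e ≡ suc b ∷ w × LongRun (b ∷ w)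

LongRun-cut : ∀ {t} → LongRun (1 ∷ t) → EarCut t
LongRun-cut {t} (y , z , r) = cut (initLast t) tail-run
  where
  x : ℕ → ℕ
  x k with r k
  ... | read {x = x} _ _ _ = x

  positive : ∀ k → 0 ℕ.< y k
  positive k with r k
  ... | read y>0 _ _ = y>0

  split : ∀ k → z k ≡ y k ℕ.+ x k
  split k with r k
  ... | read {x = x} _ eq _ = trans (sym (ℕₚ.+-identityʳ (z k))) (sym eq)

  tail-run : ∀ k → Run t (y k ℕ.+ x k) (x k) (y (suc k)) (y (suc k) ℕ.+ x (suc k))
  tail-run k = subst₂ (λ p q → Run t p (x k) (y (suc k)) q) (split k) (split (suc k)) (go k)
    where
    go : ∀ k → Run t (z k) (x k) (y (suc k)) (z (suc k))
    go k with r k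
    ... | read _ _ r = r

  cut : ∀ {t} → InitLast t →
        (∀ k → Run t (y k ℕ.+ x k) (x k) (y (suc k)) (y (suc k) ℕ.+ x (suc k))) →
        EarCut t
  -- For the word `1` alone two consecutive periods overlap so much that
  -- `x ≡ y′ + x′ ≥ y′ ≡ y + x > x`.
  cut []            r = ⊥-elim (Run-loop (positive 0) (positive 1) (r 0))
    where
    Run-loop : ∀ {y x y′ x′} → 0 ℕ.< y → 0 ℕ.< y′ → ¬ Run [] (y ℕ.+ x) x y′ (y′ ℕ.+ x′)
    Run-loop {y} {x} {y′} {x′} y>0 y′>0 r with Run-[]⁻ r
    ... | y+x≡y′ , x≡y′+x′ = ℕₚ.<-irrefl refl (begin-strict
      x          <⟨ ℕₚ.m<n+m x y>0 ⟩
      y ℕ.+ x    ≡⟨ y+x≡y′ ⟩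
      y′         ≤⟨ ℕₚ.m≤m+n y′ x′ ⟩
      y′ ℕ.+ x′  ≡⟨ x≡y′+x′ ⟨
      x          ∎)
      where open ℕₚ.≤-Reasoning
  cut (u ∷ʳ′ zero)  r = case All.++⁻ʳ u (Run-positive (r 0)) of λ { (() ∷ _) }
  cut (u ∷ʳ′ suc e) r with u ∷ʳ e in eq | (λ k → Run-decrement-last u (r k))
  ... | []         | _  = ⊥-elim (∷ʳ≢[] u eq)
    where
    ∷ʳ≢[] : ∀ u {e : ℕ} → u ∷ʳ e ≢ []
    ∷ʳ≢[] [] ()
    ∷ʳ≢[] (_ ∷ _) ()
  -- Either `t` began with 0, or `t` was the single entry 1, already lowered to 0 as the last entry.
  -- The lowered word still has a positive run, which rules out both.
  ... | zero ∷ w   | r′ = case Run-positive (r′ 0) of λ { (() ∷ _) }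
  ... | suc b ∷ w  | r′ =
    u , e , b , w , refl , eq , y , x , λ k → Run-decrement-head (positive k) (r′ k)

Run-applyUpTo : ∀ (y a : ℕ → ℕ) → (∀ j → 0 ℕ.< y j) →
  (∀ j → y j ℕ.+ y (suc (suc j)) ≡ a j ℕ.* y (suc j)) →
  ∀ n → Run (applyUpTo a n) (y 0) (y 1) (y n) (y (suc n))
Run-applyUpTo y a pos rec zero    = []
Run-applyUpTo y a pos rec (suc n) =
  read (pos 0) (rec 0) (Run-applyUpTo (λ j → y (suc j)) (λ j → a (suc j))
                                      (λ j → pos (suc j)) (λ j → rec (suc j)) n)

small-entry : ∀ {w} → All (1 ℕ.≤_) w →
  All (2 ℕ.≤_) w ⊎ Σ[ u ∈ List ℕ ] Σ[ v ∈ List ℕ ] w ≡ u ++ 1 ∷ v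
small-entry [] = inj₁ []
small-entry {suc zero ∷ w} (_ ∷ _) = inj₂ ([] , w , refl)
small-entry {suc (suc x) ∷ w} (_ ∷ ps) with small-entry ps
... | inj₁ qs = inj₁ (s≤s (s≤s z≤n) ∷ qs)
... | inj₂ (u , v , eq) = inj₂ (_ ∷ u , v , cong (_ ∷_) eq)

-- Gluing an ear to a triangulation of the punctured disc

quotient-mono : ∀ {N r r′ q q′} → r′ ℕ.< N →
                + r + q * + N ≤ + r′ + q′ * + N → q ≤ q′
quotient-mono {N} {r} {r′} {q} {q′} r′<N le with q ℤₚ.≤? q′
... | yes q≤q′ = q≤q′
... | no  q≰q′ = ⊥-elim (ℤₚ.<⇒≱ (begin-strict
  + r′ + q′ * + N       <⟨ ℤₚ.+-monoˡ-< (q′ * + N) (ℤ.+<+ r′<N) ⟩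
  + N + q′ * + N        ≡⟨ ℤₚ.suc-* q′ (+ N) ⟨
  ℤ.suc q′ * + N        ≤⟨ ℤₚ.*-monoʳ-≤-nonNeg (+ N) (ℤₚ.i<j⇒suc[i]≤j (ℤₚ.≰⇒> q≰q′)) ⟩
  q * + N               ≤⟨ ℤₚ.i≤j+i _ (+ r) ⟩
  + r + q * + N         ∎) le)
  where open ℤₚ.≤-Reasoning

quotient-unique : ∀ {N r r′ q q′} → r ℕ.< N → r′ ℕ.< N →
                  + r + q * + N ≡ + r′ + q′ * + N → q ≡ q′
quotient-unique {N} {r} {r′} r<N r′<N eq =
  ℤₚ.≤-antisym (quotient-mono {r = r} r′<N (ℤₚ.≤-reflexive eq))
               (quotient-mono {r = r′} r<N (ℤₚ.≤-reflexive (sym eq)))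

remainder-unique : ∀ {N r r′ q q′} → r ℕ.< N → r′ ℕ.< N →
                   + r + q * + N ≡ + r′ + q′ * + N → r ≡ r′
remainder-unique {N} {r} {r′} {q} {q′} r<N r′<N eq
  with quotient-unique {N} {r} {r′} {q} {q′} r<N r′<N eq
... | refl = ℤₚ.+-injective (cancel-multiple eq)
  where
  cancel-multiple : + r + q * + N ≡ + r′ + q * + N → + r ≡ + r′
  cancel-multiple eq = trans (sym (undo (+ r) (q * + N)))
    (trans (cong (_- q * + N) eq) (undo (+ r′) (q * + N)))
    where
    undo : ∀ x y → x + y - y ≡ x
    undo = solve-∀

<+1⇒≤ : ∀ {i j} → i < j + 1ℤ → i ≤ j
<+1⇒≤ {i} {j} i<j+1 = ℤₚ.≮⇒≥ λ j<i →
  ℤₚ.<⇒≱ i<j+1 (subst (_≤ i) (ℤₚ.+-comm 1ℤ j) (ℤₚ.i<j⇒suc[i]≤j j<i))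

<⇒+1≤ : ∀ {i j} → i < j → i + 1ℤ ≤ j
<⇒+1≤ {i} {j} i<j = subst (_≤ j) (ℤₚ.+-comm 1ℤ i) (ℤₚ.i<j⇒suc[i]≤j i<j)

i<i+1 : ∀ i → i < i + 1ℤ
i<i+1 i = subst (_< i + 1ℤ) (ℤₚ.+-identityʳ i) (ℤₚ.+-monoʳ-< i 0<1)
  where
  0<1 : 0ℤ < 1ℤ
  0<1 = ℤ.+<+ (s≤s z≤n)

module _ {a b p q} {A : Set a} {B : Set b} {P : Pred B p} {Q : Pred A q}
         (P? : Decidable P) (Q? : Decidable Q) where

  count-map : ∀ (f : A → B) → (∀ x → P (f x) → Q x) → (∀ x → Q x → P (f x)) → ∀ xs →
              length (filter P? (map f xs)) ≡ length (filter Q? xs)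
  count-map f P⇒Q Q⇒P [] = refl
  count-map f P⇒Q Q⇒P (x ∷ xs) with Q? x
  ... | yes q rewrite filter-accept P? {xs = map f xs} (Q⇒P x q) =
    cong suc (count-map f P⇒Q Q⇒P xs)
  ... | no ¬q rewrite filter-reject P? {xs = map f xs} (¬q ∘ P⇒Q x) =
    count-map f P⇒Q Q⇒P xs

module Disc (N : ℕ) = MarkedSurface (puncturedDisc N)

mapLift : (ℤ → ℤ) → DiscLift → DiscLift
mapLift f (chord i j) = chord (f i) (f j)
mapLift f (spoke i)   = spoke (f i)

-- The monotone relabelling ℤ → ℤ which opens a gap for one new marked point,
-- labelled 0, between the old points c - 1 and c.
module Opening (n : ℕ) (c : ℤ) where

  N M : ℕ
  N = suc n
  M = suc N

  f : ℤ → ℤ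
  f x = 1ℤ + (x - c) + (x - c) /ℕ N

  -- Since `q * N + q ≡ q * M`, quotients are kept and a remainder `r` modulo `N` becomes `suc r`
  -- modulo `M`. The remainder 0 is left free for the new points.
  f-value : ∀ q {r} → r ℕ.< N → f (c + (+ r + q * + N)) ≡ 1ℤ + + r + q * + M
  f-value q {r} r<N = begin
    1ℤ + (c + z - c) + (c + z - c) /ℕ N  ≡⟨ cong (λ y → 1ℤ + y + y /ℕ N) (cancel c z) ⟩
    1ℤ + z + z /ℕ N                      ≡⟨ cong (λ y → 1ℤ + z + y) quotient ⟩
    1ℤ + z + q                           ≡⟨ regroup (+ r) q (+ N) ⟩
    1ℤ + + r + q * + M                   ∎
    where
    open ≡-Reasoning
    z = + r + q * + N
    cancel : ∀ c z → c + z - c ≡ z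
    cancel = solve-∀
    regroup : ∀ r q N → 1ℤ + (r + q * N) + q ≡ 1ℤ + r + q * (1ℤ + N)
    regroup = solve-∀
    quotient : z /ℕ N ≡ q
    quotient = quotient-unique {r = z %ℕ N} (n%ℕd<d z N) r<N (sym (a≡a%ℕn+[a/ℕn]*n z N))

  decompose : ∀ x → Σ[ r ∈ ℕ ] Σ[ q ∈ ℤ ] r ℕ.< N × x ≡ c + (+ r + q * + N)
  decompose x = (x - c) %ℕ N , (x - c) /ℕ N , n%ℕd<d (x - c) N ,
    trans (restore x c) (cong (_+_ c) (a≡a%ℕn+[a/ℕn]*n (x - c) N))
    where
    restore : ∀ x c → x ≡ c + (x - c)
    restore = solve-∀

  f-shift : ∀ t x → f (x + t * + N) ≡ f x + t * + M
  f-shift t x with decompose x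
  ... | r , q , r<N , refl = begin
    f (c + (+ r + q * + N) + t * + N)  ≡⟨ cong f (regroup c (+ r) q t (+ N)) ⟩
    f (c + (+ r + (q + t) * + N))      ≡⟨ f-value (q + t) r<N ⟩
    1ℤ + + r + (q + t) * + M           ≡⟨ split (+ r) q t (+ M) ⟩
    1ℤ + + r + q * + M + t * + M       ≡⟨ cong (_+ t * + M) (f-value q r<N) ⟨
    f (c + (+ r + q * + N)) + t * + M  ∎
    where
    open ≡-Reasoning
    regroup : ∀ c r q t N → c + (r + q * N) + t * N ≡ c + (r + (q + t) * N)
    regroup = solve-∀
    split : ∀ r q t M → 1ℤ + r + (q + t) * M ≡ 1ℤ + r + q * M + t * M
    split = solve-∀

  f-mono : ∀ {x y} → x < y → f x < f y
  f-mono {x} {y} x<y =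
    ℤₚ.+-mono-<-≤ (ℤₚ.+-monoʳ-< 1ℤ x-c<y-c)
      (quotient-mono {r = (x - c) %ℕ N} (n%ℕd<d (y - c) N)
        (subst₂ _≤_ (a≡a%ℕn+[a/ℕn]*n (x - c) N) (a≡a%ℕn+[a/ℕn]*n (y - c) N)
                (ℤₚ.<⇒≤ x-c<y-c)))
    where
    x-c<y-c : x - c < y - c
    x-c<y-c = ℤₚ.+-monoˡ-< (- c) x<y

  f-reflect : ∀ {x y} → f x < f y → x < y
  f-reflect {x} {y} fx<fy with ℤₚ.<-cmp x y
  ... | tri< x<y _ _  = x<y
  ... | tri≈ _ refl _ = ⊥-elim (ℤₚ.<-irrefl refl fx<fy)
  ... | tri> _ _ y<x  = ⊥-elim (ℤₚ.<-asym fx<fy (f-mono y<x))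

  f-injective : ∀ {x y} → f x ≡ f y → x ≡ y
  f-injective {x} {y} fx≡fy with ℤₚ.<-cmp x y
  ... | tri< x<y _ _ = ⊥-elim (ℤₚ.<-irrefl fx≡fy (f-mono x<y))
  ... | tri≈ _ x≡y _ = x≡y
  ... | tri> _ _ y<x = ⊥-elim (ℤₚ.<-irrefl (sym fx≡fy) (f-mono y<x))

  f-c : f c ≡ 1ℤ
  f-c = trans (cong f (at-zero c (+ N))) (f-value 0ℤ (s≤s z≤n))
    where
    at-zero : ∀ c N → c ≡ c + (0ℤ + 0ℤ * N)
    at-zero = solve-∀

  f-c-1 : f (c - 1ℤ) ≡ -1ℤ
  f-c-1 = trans (cong f (at-last c (+ n))) (trans (f-value -1ℤ (ℕₚ.n<1+n n)) (value (+ n)))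
    where
    at-last : ∀ c n → c - 1ℤ ≡ c + (n + -1ℤ * (1ℤ + n))
    at-last = solve-∀
    value : ∀ n → 1ℤ + n + -1ℤ * (1ℤ + (1ℤ + n)) ≡ -1ℤ
    value = solve-∀

  f-avoids : ∀ x t → f x ≢ t * + M
  f-avoids x t eq with decompose x
  ... | r , q , r<N , refl =
    case remainder-unique {r = suc r} {q = q} {q′ = t} (s≤s r<N) (s≤s z≤n)
           (trans (sym (f-value q r<N)) (trans eq (sym (ℤₚ.+-identityˡ (t * + M))))) of λ ()

  f-covers : ∀ y → (Σ[ t ∈ ℤ ] y ≡ t * + M) ⊎ (Σ[ x ∈ ℤ ] y ≡ f x)
  f-covers y with y %ℕ M | n%ℕd<d y M | a≡a%ℕn+[a/ℕn]*n y M
  ... | zero  | _         | eq = inj₁ (y /ℕ M , trans eq (ℤₚ.+-identityˡ _))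
  ... | suc r | s≤s r<N   | eq =
    inj₂ (c + (+ r + y /ℕ M * + N) , trans eq (sym (f-value (y /ℕ M) r<N)))

  lift : DiscLift → DiscLift
  lift = mapLift f

  lift-injective : ∀ {α β} → lift α ≡ lift β → α ≡ β
  lift-injective {chord i j} {chord k l} eq =
    cong₂ chord (f-injective (left eq)) (f-injective (right eq))
    where
    left : ∀ {i j k l} → chord i j ≡ chord k l → i ≡ k
    left refl = refl
    right : ∀ {i j k l} → chord i j ≡ chord k l → j ≡ l
    right refl = refl
  lift-injective {spoke i} {spoke k} eq = cong spoke (f-injective (tip eq))
    where
    tip : ∀ {i k} → spoke i ≡ spoke k → i ≡ k
    tip refl = refl

  lift-translate : ∀ t α → Disc.translate M t (lift α) ≡ lift (Disc.translate N t α)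
  lift-translate t (chord i j) = sym (cong₂ chord (f-shift t i) (f-shift t j))
  lift-translate t (spoke i)   = sym (cong spoke (f-shift t i))

  lift-separates : ∀ α β → Disc.Separates N α β → Disc.Separates M (lift α) (lift β)
  lift-separates (chord i j) (chord k l) (inj₁ (p , q , r)) = inj₁ (f-mono p , f-mono q , f-mono r)
  lift-separates (chord i j) (chord k l) (inj₂ (p , q , r)) = inj₂ (f-mono p , f-mono q , f-mono r)
  lift-separates (chord i j) (spoke k)   (p , q)            = f-mono p , f-mono q
  lift-separates (spoke k)   (chord i j) (p , q)            = f-mono p , f-mono q

  unlift-separates : ∀ α β → Disc.Separates M (lift α) (lift β) → Disc.Separates N α β
  unlift-separates (chord i j) (chord k l) (inj₁ (p , q , r)) =
    inj₁ (f-reflect p , f-reflect q , f-reflect r)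
  unlift-separates (chord i j) (chord k l) (inj₂ (p , q , r)) =
    inj₂ (f-reflect p , f-reflect q , f-reflect r)
  unlift-separates (chord i j) (spoke k)   (p , q)            = f-reflect p , f-reflect q
  unlift-separates (spoke k)   (chord i j) (p , q)            = f-reflect p , f-reflect q

  lift-crosses : ∀ α β →
                 Crosses (puncturedDisc N) α β → Crosses (puncturedDisc M) (lift α) (lift β)
  lift-crosses α β (t , s) =
    t , subst (λ γ → Disc.Separates M γ (lift β)) (sym (lift-translate t α)) (lift-separates _ β s)

  unlift-crosses : ∀ α β →
                   Crosses (puncturedDisc M) (lift α) (lift β) → Crosses (puncturedDisc N) α β
  unlift-crosses α β (t , s) =
    t , unlift-separates _ β (subst (λ γ → Disc.Separates M γ (lift β)) (lift-translate t α) s)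

  lift-isotopic : ∀ {α β} →
                  Isotopic (puncturedDisc N) α β → Isotopic (puncturedDisc M) (lift α) (lift β)
  lift-isotopic {α} (t , eq) = t , trans (lift-translate t α) (cong lift eq)

  unlift-isotopic : ∀ {α β} →
                    Isotopic (puncturedDisc M) (lift α) (lift β) → Isotopic (puncturedDisc N) α β
  unlift-isotopic {α} (t , eq) = t , lift-injective (trans (sym (lift-translate t α)) eq)

  lift-essential : ∀ α → Disc.Essential N α → Disc.Essential M (lift α)
  lift-essential (chord i j) i+1<j =
    ℤₚ.≤-<-trans (<⇒+1≤ (f-mono (i<i+1 i))) (f-mono i+1<j)
  lift-essential (spoke i)   _     = tt

  lift-arc : ∀ {α} → IsArc (puncturedDisc N) α → IsArc (puncturedDisc M) (lift α)
  lift-arc {α} (ess , simple) = lift-essential α ess , simple ∘ unlift-crosses α α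

  -- The boundary segment over which the gap opens; its lift cuts off the new
  -- marked point.
  segment : DiscLift
  segment = chord (c - 1ℤ) c

  segment-gap : ∀ t {x} → c - 1ℤ + t * + N < x → ¬ (x < c + t * + N)
  segment-gap t {x} lo hi = ℤₚ.<⇒≱ hi (subst (_≤ x) (regroup c (t * + N)) (<⇒+1≤ lo))
    where
    regroup : ∀ c s → c - 1ℤ + s + 1ℤ ≡ c + s
    regroup = solve-∀

  segment-uncrossed : ∀ β → ¬ Crosses (puncturedDisc N) segment β
  segment-uncrossed (chord k l) (t , inj₁ (p , q , _)) = segment-gap t p q
  segment-uncrossed (chord k l) (t , inj₂ (_ , p , q)) = segment-gap t p q
  segment-uncrossed (spoke k)   (t , p , q)            = segment-gap t p q

  segment-not-essential : ∀ {β} → Disc.Essential N β → ¬ Isotopic (puncturedDisc N) segment β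
  segment-not-essential ess (t , refl) = ℤₚ.<-irrefl (regroup c (t * + N)) ess
    where
    regroup : ∀ c s → c - 1ℤ + s + 1ℤ ≡ c + s
    regroup = solve-∀

  ear-arc : IsArc (puncturedDisc M) (lift segment)
  ear-arc = subst₂ (λ x y → x + 1ℤ < y) (sym f-c-1) (sym f-c) (ℤ.+<+ (s≤s z≤n)) ,
            segment-uncrossed segment ∘ unlift-crosses segment segment

  -- Pulling back can only fail when the old endpoints become adjacent. The chord is essential in
  -- the larger disc, so something lies between its endpoints there; an old point would lie strictly
  -- between `i` and `i + 1`, so it is a new point, and the chord is a translate of the ear.
  unlift-arc : ∀ α → IsArc (puncturedDisc M) (lift α) →
               Isotopic (puncturedDisc M) (lift α) (lift segment) ⊎ IsArc (puncturedDisc N) α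
  unlift-arc (spoke i)   (_ , simple) = inj₂ (tt , simple ∘ lift-crosses (spoke i) (spoke i))
  unlift-arc (chord i j) (ess , simple) with ℤₚ.<-cmp (i + 1ℤ) j
  ... | tri< i+1<j _ _ = inj₂ (i+1<j , simple ∘ lift-crosses (chord i j) (chord i j))
  ... | tri> _ _ j<i+1 = ⊥-elim
    (ℤₚ.<⇒≱ (f-reflect {i} {j} (ℤₚ.<-trans (i<i+1 (f i)) ess)) (<+1⇒≤ j<i+1))
  ... | tri≈ _ refl _ with f-covers (f i + 1ℤ)
  ...   | inj₂ (x , eq) = ⊥-elim (ℤₚ.<⇒≱ (f-reflect {x} {i + 1ℤ} (subst (_< f (i + 1ℤ)) eq ess))
                            (<⇒+1≤ (f-reflect {i} {x} (subst (f i <_) eq (i<i+1 (f i))))))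
  ...   | inj₁ (t , eq) =
    inj₁ (- t , trans (lift-translate (- t) (chord i (i + 1ℤ))) (cong lift (cong₂ chord i≡
      (trans (shift i (- t * + N)) (trans (cong (_+ 1ℤ) i≡) (restore c))))))
    where
    shift : ∀ i s → i + 1ℤ + s ≡ i + s + 1ℤ
    shift = solve-∀
    restore : ∀ c → c - 1ℤ + 1ℤ ≡ c
    restore = solve-∀
    i≡ : i + - t * + N ≡ c - 1ℤ
    i≡ = f-injective (begin
      f (i + - t * + N)       ≡⟨ f-shift (- t) i ⟩
      f i + - t * + M         ≡⟨ regroup (f i) t (+ M) ⟩
      f i + 1ℤ - t * + M - 1ℤ ≡⟨ cong (λ x → x - t * + M - 1ℤ) eq ⟩
      t * + M - t * + M - 1ℤ  ≡⟨ cong (_- 1ℤ) (ℤₚ.+-inverseʳ (t * + M)) ⟩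
      0ℤ - 1ℤ                 ≡⟨ f-c-1 ⟨
      f (c - 1ℤ)              ∎)
      where
      open ≡-Reasoning
      regroup : ∀ x t M → x + - t * M ≡ x + 1ℤ - t * M - 1ℤ
      regroup = solve-∀

  new-inside : ∀ t → f (c - 1ℤ) < t * + M + - t * + M × t * + M + - t * + M < f c
  new-inside t = subst₂ _<_ (sym f-c-1) (cancel t (+ M)) ℤ.-<+ ,
                 subst₂ _<_ (cancel t (+ M)) (sym f-c) (ℤ.+<+ (s≤s z≤n))
    where
    cancel : ∀ t M → 0ℤ ≡ t * M + - t * M
    cancel = solve-∀

  -- An end at the new point `t * M` is moved by the translation `- t` to 0, strictly between the
  -- ends -1 and 1 of the ear. A spoke from 0 leaves through the ear, and a chord does too because
  -- being essential forces its other end beyond -1 or 1.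
  lift-covers : ∀ α → (Σ[ β ∈ DiscLift ] α ≡ lift β) ⊎
                      (Disc.Essential M α → Crosses (puncturedDisc M) α (lift segment))
  lift-covers (spoke i) with f-covers i
  ... | inj₂ (x , refl) = inj₁ (spoke x , refl)
  ... | inj₁ (t , refl) = inj₂ λ _ → - t , new-inside t
  lift-covers (chord i j) with f-covers i
  ... | inj₁ (t , refl) = inj₂ λ ess → - t , inj₂ (proj₁ (new-inside t) , proj₂ (new-inside t) , wide ess)
    where
    cancel+1 : ∀ t M → t * M + 1ℤ + - t * M ≡ 1ℤ
    cancel+1 = solve-∀
    wide : t * + M + 1ℤ < j → f c < j + - t * + M
    wide ess = subst (_< j + - t * + M) (trans (cancel+1 t (+ M)) (sym f-c))
                     (ℤₚ.+-monoˡ-< (- t * + M) ess)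
  ... | inj₂ (x , refl) with f-covers j
  ...   | inj₂ (y , refl) = inj₁ (chord x y , refl)
  ...   | inj₁ (t , refl) = inj₂ λ ess → - t , inj₁ (wide ess , new-inside t)
    where
    cancel-1 : ∀ t M → t * M + - 1ℤ + - t * M ≡ - 1ℤ
    cancel-1 = solve-∀
    undo : ∀ x → x + 1ℤ + - 1ℤ ≡ x
    undo = solve-∀
    wide : f x + 1ℤ < t * + M → f x + - t * + M < f (c - 1ℤ)
    wide ess = subst (f x + - t * + M <_) (trans (cancel-1 t (+ M)) (sym f-c-1))
                     (ℤₚ.+-monoˡ-< (- t * + M)
                       (subst (_< t * + M + -1ℤ) (undo (f x)) (ℤₚ.+-monoˡ-< -1ℤ ess)))

  module _ (T : Triangulation (puncturedDisc N)) where
    open Triangulation T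

    addEar : Triangulation (puncturedDisc M)
    addEar = record
      { arcs        = map lift (segment ∷ arcs)
      ; areArcs     = ear-arc ∷ All.map⁺ (All.map lift-arc areArcs)
      ; distinct    = AllPairs.map⁺ (AllPairs.map
          (λ {α} {β} → _∘ unlift-isotopic {α} {β}) distinct′)
      ; noncrossing = AllPairs.map⁺ (AllPairs.map
          (λ {α} {β} → _∘ unlift-crosses α β) noncrossing′)
      ; maximal     = maximal′
      }
      where
      -- Before lifting, `segment` is a boundary segment: it is uncrossed, and it differs from every
      -- arc because it is not essential. It becomes an arc only in the larger disc.
      distinct′ : AllPairs (λ α β → ¬ Isotopic (puncturedDisc N) α β) (segment ∷ arcs)
      distinct′ = All.map (λ {β} arc → segment-not-essential {β} (proj₁ arc)) areArcs ∷ distinct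

      noncrossing′ : AllPairs (λ α β → ¬ Crosses (puncturedDisc N) α β) (segment ∷ arcs)
      noncrossing′ = All.universal segment-uncrossed arcs ∷ noncrossing

      maximal′ : ∀ α → IsArc (puncturedDisc M) α →
                 All (λ β → ¬ Crosses (puncturedDisc M) α β) (map lift (segment ∷ arcs)) →
                 Any (Isotopic (puncturedDisc M) α) (map lift (segment ∷ arcs))
      -- Not crossing the ear excludes ends at new points. The remaining candidates are the ear
      -- itself and lifts of arcs, to which the maximality of `T` applies.
      maximal′ α arc (¬ear ∷ ¬crosses) with lift-covers α
      ... | inj₂ crosses-ear = ⊥-elim (¬ear (crosses-ear (proj₁ arc)))
      ... | inj₁ (β , refl) with unlift-arc β arc
      ...   | inj₁ isotopic = here isotopic
      ...   | inj₂ arc′     = there (Any.map⁺ (Any.map lift-isotopic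
                (maximal β arc′ (All.map (λ {γ} → _∘ lift-crosses β γ) (All.map⁻ ¬crosses)))))

    ends-lift : ∀ αs → concatMap (Disc.ends M tt) (map lift αs) ≡
                       map f (concatMap (Disc.ends N tt) αs)
    ends-lift []                = refl
    ends-lift (chord i j ∷ αs) = cong (λ xs → f i ∷ f j ∷ xs) (ends-lift αs)
    ends-lift (spoke i ∷ αs)   = cong (f i ∷_) (ends-lift αs)

    -- As `f` is injective and turns translation by `N` into translation by `M`, it preserves and
    -- reflects congruence of labels. The ends at `f x` are thus the ends at `x` together with those
    -- of the ear; for `N = 1` both ends of the ear lie at the same point.
    regionsAt-old : ∀ x → regionsAt (puncturedDisc M) addEar tt (f x) ≡
      suc (length (filter (λ y → + N ∣? (y - x))
                          (c - 1ℤ ∷ c ∷ concatMap (Disc.ends N tt) arcs)))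
    regionsAt-old x = cong suc (begin
      count (concatMap (Disc.ends M tt) (map lift (segment ∷ arcs)))
        ≡⟨ cong count (ends-lift (segment ∷ arcs)) ⟩
      count (map f (c - 1ℤ ∷ c ∷ concatMap (Disc.ends N tt) arcs))
        ≡⟨ count-map (λ y → + M ∣? (y - f x)) (λ y → + N ∣? (y - x)) f
                     unlift-∣ lift-∣ (c - 1ℤ ∷ c ∷ concatMap (Disc.ends N tt) arcs) ⟩
      length (filter (λ y → + N ∣? (y - x)) (c - 1ℤ ∷ c ∷ concatMap (Disc.ends N tt) arcs)) ∎)
      where
      open ≡-Reasoning
      count : List ℤ → ℕ
      count xs = length (filter (λ y → + M ∣? (y - f x)) xs)
      undo : ∀ x s → x + s - x ≡ s
      undo = solve-∀
      redo : ∀ y x → y ≡ x + (y - x)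
      redo = solve-∀
      unlift-∣ : ∀ y → + M ∣ (f y - f x) → + N ∣ (y - x)
      unlift-∣ y (divides q eq) = divides q (trans (cong (_- x) y≡) (undo x (q * + N)))
        where
        y≡ : y ≡ x + q * + N
        y≡ = f-injective (trans (redo (f y) (f x)) (trans (cong (_+_ (f x)) eq) (sym (f-shift q x))))
      lift-∣ : ∀ y → + N ∣ (y - x) → + M ∣ (f y - f x)
      lift-∣ y (divides q eq) = divides q (begin
        f y - f x                   ≡⟨ cong (λ z → f z - f x) (trans (redo y x) (cong (_+_ x) eq)) ⟩
        f (x + q * + N) - f x       ≡⟨ cong (_- f x) (f-shift q x) ⟩
        f x + q * + M - f x         ≡⟨ undo (f x) (q * + M) ⟩
        q * + M                     ∎)

    regionsAt-new : regionsAt (puncturedDisc M) addEar tt 0ℤ ≡ 1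
    regionsAt-new = cong (suc ∘ length) (trans
      (cong (filter (λ y → + M ∣? (y - 0ℤ)))
            {y = map f (concatMap (Disc.ends N tt) (segment ∷ arcs))}
            (ends-lift (segment ∷ arcs)))
      (filter-none (λ y → + M ∣? (y - 0ℤ)) (All.map⁺ {f = f} (All.universal avoid
        (concatMap (Disc.ends N tt) (segment ∷ arcs))))))
      where
      avoid : ∀ x → ¬ (+ M ∣ (f x - 0ℤ))
      avoid x (divides q eq) = f-avoids x q (trans (sym (ℤₚ.+-identityʳ (f x))) eq)

-- Sequences of triangulations of the punctured disc

applyUpTo-cong : ∀ {a} {A : Set a} {f g : ℕ → A} n → (∀ {i} → i ℕ.< n → f i ≡ g i) →
                 applyUpTo f n ≡ applyUpTo g n
applyUpTo-cong zero    eq = refl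
applyUpTo-cong (suc n) eq = cong₂ _∷_ (eq ℕ.z<s) (applyUpTo-cong n (eq ∘ ℕ.s<s))

applyUpTo-injective : ∀ {a} {A : Set a} (f g : ℕ → A) {n} → applyUpTo f n ≡ applyUpTo g n →
                      ∀ {i} → i ℕ.< n → f i ≡ g i
applyUpTo-injective f g {suc n} eq {zero}  _         = proj₁ (∷-injective eq)
applyUpTo-injective f g {suc n} eq {suc i} (s≤s i<n) =
  applyUpTo-injective (f ∘ suc) (g ∘ suc) (proj₂ (∷-injective eq)) i<n

constant-applyUpTo : ∀ {a} {A : Set a} {x : A} {w} →
                     All (_≡ x) w → w ≡ applyUpTo (λ _ → x) (length w)
constant-applyUpTo []          = refl
constant-applyUpTo (refl ∷ eq) = cong (_ ∷_) (constant-applyUpTo eq)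

count-unique : ∀ {a p} {A : Set a} {P : Pred A p} (P? : Decidable P) (h : ℕ → A) n {s} →
               s ℕ.< n → P (h s) → (∀ {r} → r ℕ.< n → P (h r) → r ≡ s) →
               length (filter P? (applyUpTo h n)) ≡ 1
count-unique P? h (suc n) {zero} _ p unique
  rewrite filter-accept P? {xs = applyUpTo (h ∘ suc) n} p =
  cong (suc ∘ length) (filter-none P?
    (All.applyUpTo⁺₁ (h ∘ suc) n (λ r<n q → ℕₚ.1+n≢0 (unique (s≤s r<n) q))))
count-unique P? h (suc n) {suc s} (s≤s s<n) p unique
  rewrite filter-reject P? {xs = applyUpTo (h ∘ suc) n} (λ q → ℕₚ.1+n≢0 (sym (unique ℕ.z<s q))) =
  count-unique P? (h ∘ suc) n s<n p (λ r<n q → ℕₚ.suc-injective (unique (s≤s r<n) q))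

module _ {a} {A : Set a} (g : ℤ → A) (N : ℕ) (periodic : ∀ x → g (x + + N) ≡ g x) where

  private
    shift-ℕ : ∀ t x → g (x + + t * + N) ≡ g x
    shift-ℕ zero    x = cong g (ℤₚ.+-identityʳ x)
    shift-ℕ (suc t) x = begin
      g (x + + suc t * + N)    ≡⟨ cong g (regroup x (+ t) (+ N)) ⟩
      g (x + + t * + N + + N)  ≡⟨ periodic _ ⟩
      g (x + + t * + N)        ≡⟨ shift-ℕ t x ⟩
      g x                      ∎
      where
      open ≡-Reasoning
      regroup : ∀ x t N → x + (1ℤ + t) * N ≡ x + t * N + N
      regroup = solve-∀

  periodic-shift : ∀ t x → g (x + t * + N) ≡ g x
  periodic-shift (+ t)        x = shift-ℕ t x
  periodic-shift ℤ.-[1+ n ] x = begin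
    g (x + ℤ.-[1+ n ] * + N)                      ≡⟨ shift-ℕ (suc n) _ ⟨
    g (x + ℤ.-[1+ n ] * + N + + suc n * + N)      ≡⟨ cong g (regroup x (+ suc n) (+ N)) ⟩
    g x                                           ∎
    where
    open ≡-Reasoning
    regroup : ∀ x t N → x + - t * N + t * N ≡ x
    regroup = solve-∀

-- The triangulation by spokes.

module _ (n : ℕ) where

  private
    N = suc n

  spokes : Triangulation (puncturedDisc N)
  spokes = record
    { arcs        = applyUpTo (spoke ∘ +_) N
    ; areArcs     = All.applyUpTo⁺₂ (spoke ∘ +_) N (λ _ → tt , λ ())
    ; distinct    = AllPairs.applyUpTo⁺₁ (spoke ∘ +_) N (λ {i} {j} → apart {i} {j})
    ; noncrossing = AllPairs.applyUpTo⁺₂ (spoke ∘ +_) N (λ _ _ ())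
    ; maximal     = maximal
    }
    where
    tip : ∀ {i j} → spoke i ≡ spoke j → i ≡ j
    tip refl = refl
    apart : ∀ {i j} → i ℕ.< j → j ℕ.< N → ¬ Isotopic (puncturedDisc N) (spoke (+ i)) (spoke (+ j))
    apart {i} {j} i<j j<N (t , eq) = ℕₚ.<⇒≢ i<j
      (remainder-unique {N} {i} {j} {t} {0ℤ} (ℕₚ.<-trans i<j j<N) j<N
        (trans (tip eq) (sym (ℤₚ.+-identityʳ (+ j)))))
    reduce : ∀ i → i + - (i /ℕ N) * + N ≡ + (i %ℕ N)
    reduce i = trans (cong (_+ - (i /ℕ N) * + N) (a≡a%ℕn+[a/ℕn]*n i N))
                     (cancel (+ (i %ℕ N)) (i /ℕ N) (+ N))
      where
      cancel : ∀ r q N → r + q * N + - q * N ≡ r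
      cancel = solve-∀
    maximal : ∀ α → IsArc (puncturedDisc N) α →
              All (λ β → ¬ Crosses (puncturedDisc N) α β) (applyUpTo (spoke ∘ +_) N) →
              Any (Isotopic (puncturedDisc N) α) (applyUpTo (spoke ∘ +_) N)
    maximal (spoke i)   _         _        =
      Any.applyUpTo⁺ (spoke ∘ +_) (- (i /ℕ N) , cong spoke (reduce i)) (n%ℕd<d i N)
    -- An essential chord passes over `i + 1`, so it crosses the spoke there; the translation brings
    -- that spoke to its representative in the list.
    maximal (chord i j) (ess , _) ¬crosses = ⊥-elim
      (All.applyUpTo⁻ (spoke ∘ +_) N ¬crosses (n%ℕd<d (i + 1ℤ) N)
        (- ((i + 1ℤ) /ℕ N) ,
         subst (i + s <_) (reduce (i + 1ℤ)) (ℤₚ.+-monoˡ-< s (i<i+1 i)) ,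
         subst (_< j + s) (reduce (i + 1ℤ)) (ℤₚ.+-monoˡ-< s ess)))
      where
      s = - ((i + 1ℤ) /ℕ N) * + N

  concatMap-spokes : ∀ (h : ℕ → ℤ) k →
                     concatMap (Disc.ends N tt) (applyUpTo (spoke ∘ h) k) ≡ applyUpTo h k
  concatMap-spokes h zero    = refl
  concatMap-spokes h (suc k) = cong (h 0 ∷_) (concatMap-spokes (h ∘ suc) k)

  regionsAt-spokes : ∀ {r} → r ℕ.< N → regionsAt (puncturedDisc N) spokes tt (+ r) ≡ 2
  regionsAt-spokes {r} r<N = cong suc (trans
    (cong (length ∘ filter (λ x → + N ∣? (x - + r))) (concatMap-spokes +_ N))
    (count-unique (λ x → + N ∣? (x - + r)) +_ N r<N (divides 0ℤ (ℤₚ.+-inverseʳ (+ r)))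
      λ {i} i<N (divides q eq) → remainder-unique {N} {i} {r} {0ℤ} {q} i<N r<N
        (trans (restore (+ i) (+ r) (+ N)) (cong (_+_ (+ r)) eq))))
    where
    restore : ∀ i r N → i + 0ℤ * N ≡ r + (i - r)
    restore = solve-∀

-- The starting point c is left free to make DiscSequence invariant under
-- rotation of w.
DiscSequence : ℕ → List ℕ → Set
DiscSequence N w = Σ[ T ∈ Triangulation (puncturedDisc N) ] Σ[ c ∈ ℤ ]
  w ≡ applyUpTo (λ r → regionsAt (puncturedDisc N) T tt (c + + r)) N

twos-DiscSequence : ∀ {n w} → length w ≡ suc n → All (_≡ 2) w → DiscSequence (suc n) w
twos-DiscSequence {n} len w≡2 = spokes n , 0ℤ ,
  trans (constant-applyUpTo w≡2) (trans (cong (applyUpTo (λ _ → 2)) len)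
    (applyUpTo-cong (suc n) (λ r<N → sym (regionsAt-spokes n r<N))))

regionsAt-periodic : ∀ N (T : Triangulation (puncturedDisc N)) x →
  regionsAt (puncturedDisc N) T tt (x + + N) ≡ regionsAt (puncturedDisc N) T tt x
regionsAt-periodic N T x = cong (suc ∘ length) (filter-≐ _ _
  ((λ {y} (divides q eq) → divides (1ℤ + q)
      (trans (up y x (+ N)) (trans (cong (_+_ (+ N)) eq) (sym (ℤₚ.suc-* q (+ N)))))) ,
   (λ {y} (divides q eq) → divides (q - 1ℤ)
      (trans (down y x (+ N)) (trans (cong (_- + N) eq) (less q (+ N))))))
  (concatMap (Disc.ends N tt) (Triangulation.arcs T)))
  where
  up : ∀ y x N → y - x ≡ N + (y - (x + N))
  up = solve-∀
  down : ∀ y x N → y - (x + N) ≡ y - x - N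
  down = solve-∀
  less : ∀ q N → q * N - N ≡ (q - 1ℤ) * N
  less = solve-∀

DiscSequence-∷ʳ : ∀ {N x w} → DiscSequence N (x ∷ w) → DiscSequence N (w ∷ʳ x)
DiscSequence-∷ʳ {suc n} {x} {w} (T , c , eq) with refl , refl ← ∷-injective eq =
  T , c + 1ℤ , (begin
    applyUpTo (g ∘ suc) n ∷ʳ g 0        ≡⟨ cong (applyUpTo (g ∘ suc) n ∷ʳ_) g-period ⟨
    applyUpTo (g ∘ suc) n ∷ʳ g (suc n)  ≡⟨ applyUpTo-∷ʳ (g ∘ suc) n ⟩
    applyUpTo (g ∘ suc) (suc n)
      ≡⟨ applyUpTo-cong (suc n) (λ {r} _ →
           cong (regionsAt (puncturedDisc (suc n)) T tt) (sym (ℤₚ.+-assoc c 1ℤ (+ r)))) ⟩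
    applyUpTo (λ r → regionsAt (puncturedDisc (suc n)) T tt (c + 1ℤ + + r)) (suc n) ∎)
  where
  open ≡-Reasoning
  g : ℕ → ℕ
  g r = regionsAt (puncturedDisc (suc n)) T tt (c + + r)
  g-period : g (suc n) ≡ g 0
  g-period = trans (regionsAt-periodic (suc n) T c)
                   (cong (regionsAt (puncturedDisc (suc n)) T tt) (sym (ℤₚ.+-identityʳ c)))

DiscSequence-rotate : ∀ {N} u v → DiscSequence N (u ++ v) → DiscSequence N (v ++ u)
DiscSequence-rotate []      v s = subst (DiscSequence _) (sym (++-identityʳ v)) s
DiscSequence-rotate (x ∷ u) v s = subst (DiscSequence _) (++-assoc v (x ∷ []) u)
  (DiscSequence-rotate u (v ∷ʳ x)
    (subst (DiscSequence _) (++-assoc u v (x ∷ [])) (DiscSequence-∷ʳ s)))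

DiscSequence-ear : ∀ {N u e b w} → u ∷ʳ e ≡ suc b ∷ w → DiscSequence N (b ∷ w) →
                   DiscSequence (suc N) (1 ∷ u ∷ʳ suc e)
DiscSequence-ear {suc n} {u} {e} {b} {w} u∷ʳe≡ (T , c , eq) = addEar T , 0ℤ ,
  cong₂ _∷_ (sym (regionsAt-new T)) (begin
    u ∷ʳ suc e                          ≡⟨ cong₂ (λ v x → v ∷ʳ suc x) u≡ e≡ ⟩
    applyUpTo h n ∷ʳ suc (h n)          ≡⟨ cong₂ _∷ʳ_ (applyUpTo-cong n early) (sym last) ⟩
    applyUpTo new n ∷ʳ new n            ≡⟨ applyUpTo-∷ʳ new n ⟩
    applyUpTo new (suc n)               ∎)
  where
  open ≡-Reasoning
  open Opening n c

  E : List ℤ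
  E = concatMap (Disc.ends N tt) (Triangulation.arcs T)

  -- `h` counts only the end `c` of the ear and so enumerates the half-raised word `suc b ∷ w`,
  -- which is also `u ∷ʳ e`. The other end, `c - 1 = c + n - N`, lies at position `n` with quotient
  -- -1 and turns `e` into `suc e`. For `n = 0` both ends raise the same entry.
  old new h : ℕ → ℕ
  old r    = regionsAt (puncturedDisc N) T tt (c + + r)
  new r    = regionsAt (puncturedDisc M) (addEar T) tt (+ suc r)
  h zero    = suc (old zero)
  h (suc r) = old (suc r)

  h-snoc : u ∷ʳ e ≡ applyUpTo h n ∷ʳ h n
  h-snoc = begin
    u ∷ʳ e                      ≡⟨ u∷ʳe≡ ⟩
    suc b ∷ w
      ≡⟨ cong₂ (λ x v → suc x ∷ v) (proj₁ (∷-injective eq)) (proj₂ (∷-injective eq)) ⟩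
    applyUpTo h (suc n)         ≡⟨ applyUpTo-∷ʳ h n ⟨
    applyUpTo h n ∷ʳ h n        ∎
  u≡ : u ≡ applyUpTo h n
  u≡ = proj₁ (∷ʳ-injective u _ h-snoc)
  e≡ : e ≡ h n
  e≡ = proj₂ (∷ʳ-injective u _ h-snoc)

  at? : ∀ r → Decidable (λ y → + N ∣ (y - (c + + r)))
  at? r y = + N ∣? (y - (c + + r))

  new-count : ∀ {r} → r ℕ.< N → new r ≡ suc (length (filter (at? r) (c - 1ℤ ∷ c ∷ E)))
  new-count {r} r<N = trans (cong (regionsAt (puncturedDisc M) (addEar T) tt) (sym position))
                            (regionsAt-old T (c + + r))
    where
    position : f (c + + r) ≡ + suc r
    position = begin
      f (c + + r)                  ≡⟨ cong (λ x → f (c + x)) (ℤₚ.+-identityʳ (+ r)) ⟨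
      f (c + (+ r + 0ℤ * + N))     ≡⟨ f-value 0ℤ r<N ⟩
      1ℤ + + r + 0ℤ * + M          ≡⟨ ℤₚ.+-identityʳ (+ suc r) ⟩
      + suc r                      ∎

  h-count : ∀ {r} → r ℕ.< N → suc (length (filter (at? r) (c ∷ E))) ≡ h r
  h-count {zero}  _   = cong (suc ∘ length) (filter-accept (at? 0) {c} {E} (divides 0ℤ (zero-offset c)))
    where
    zero-offset : ∀ c → c - (c + 0ℤ) ≡ 0ℤ
    zero-offset = solve-∀
  h-count {suc r} r<N = cong (suc ∘ length) (filter-reject (at? (suc r)) {c} {E} λ { (divides q eq) →
    case remainder-unique {N} {suc r} {0} {q} {0ℤ} r<N (s≤s z≤n)
      (trans (cong (_+_ (+ suc r)) (sym eq)) (offset c (+ suc r) (+ N))) of λ () })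
    where
    offset : ∀ c r N → r + (c - (c + r)) ≡ 0ℤ + 0ℤ * N
    offset = solve-∀

  offset-last : ∀ c r n → r + (c - 1ℤ - (c + r)) ≡ n + -1ℤ * (1ℤ + n)
  offset-last = solve-∀

  early : ∀ {r} → r ℕ.< n → h r ≡ new r
  early {r} r<n = begin
    h r                                                    ≡⟨ h-count r<N ⟨
    suc (length (filter (at? r) (c ∷ E)))
      ≡⟨ cong (suc ∘ length) (filter-reject (at? r) {c - 1ℤ} {c ∷ E} λ { (divides q eq) → ℕₚ.<⇒≢ r<n
           (remainder-unique {N} {r} {n} {q} { -1ℤ} r<N (ℕₚ.n<1+n n)
             (trans (cong (_+_ (+ r)) (sym eq)) (offset-last c (+ r) (+ n)))) }) ⟨
    suc (length (filter (at? r) (c - 1ℤ ∷ c ∷ E)))         ≡⟨ new-count r<N ⟨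
    new r                                                  ∎
    where
    r<N : r ℕ.< N
    r<N = ℕₚ.m<n⇒m<1+n r<n

  last : new n ≡ suc (h n)
  last = begin
    new n                                                  ≡⟨ new-count (ℕₚ.n<1+n n) ⟩
    suc (length (filter (at? n) (c - 1ℤ ∷ c ∷ E)))
      ≡⟨ cong (suc ∘ length) (filter-accept (at? n) {c - 1ℤ} {c ∷ E} (divides -1ℤ (wrap c (+ n)))) ⟩
    suc (suc (length (filter (at? n) (c ∷ E))))            ≡⟨ cong suc (h-count (ℕₚ.n<1+n n)) ⟩
    suc (h n)                                              ∎
    where
    wrap : ∀ c n → c - 1ℤ - (c + n) ≡ -1ℤ * (1ℤ + n)
    wrap = solve-∀

-- Induction on the length of the cyclic word.

disc-or-hyperbolic : ∀ N w → length w ≡ suc N → LongRun w →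
                     DiscSequence (suc N) w ⊎ + 2 < trace (monodromy w)
disc-or-hyperbolic N w len run@(_ , _ , r) with small-entry (Run-positive (r 0))
... | inj₁ 2≤w with twos-or-hyperbolic 2≤w
...   | inj₁ w≡2 = inj₁ (twos-DiscSequence len w≡2)
...   | inj₂ hyp = inj₂ hyp
disc-or-hyperbolic N w len run | inj₂ (u , v , refl)
  with LongRun-cut (LongRun-rotate u (1 ∷ v) run)
... | u′ , e , b , w′ , vu≡ , eq , run′ = done N len-cut
  where
  len-cut : length (b ∷ w′) ≡ N
  len-cut = ℕₚ.suc-injective (begin
    suc (length (suc b ∷ w′))      ≡⟨ cong (suc ∘ length) eq ⟨
    suc (length (u′ ∷ʳ e))         ≡⟨ cong suc (trans (length-++ u′) (sym (length-++ u′))) ⟩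
    suc (length (u′ ∷ʳ suc e))     ≡⟨ cong (suc ∘ length) vu≡ ⟨
    length (1 ∷ v ++ u)            ≡⟨ length-++-comm (1 ∷ v) u ⟩
    length (u ++ 1 ∷ v)            ≡⟨ len ⟩
    suc N                          ∎)
    where open ≡-Reasoning
  -- The cut word is nonempty, so its length is again a successor; matching on it makes the
  -- recursive call structurally smaller.
  done : ∀ N → length (b ∷ w′) ≡ N →
         DiscSequence (suc N) (u ++ 1 ∷ v) ⊎ + 2 < trace (monodromy (u ++ 1 ∷ v))
  done (suc N) len′ with disc-or-hyperbolic N (b ∷ w′) len′ run′
  ... | inj₁ disc = inj₁ (DiscSequence-rotate (1 ∷ v) u
        (subst (λ t → DiscSequence _ (1 ∷ t)) (sym vu≡) (DiscSequence-ear eq disc)))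
  ... | inj₂ hyp  = inj₂ (subst (+ 2 <_) (sym (begin
        trace (monodromy (u ++ 1 ∷ v))         ≡⟨ trace-rotate u (1 ∷ v) ⟩
        trace (monodromy (1 ∷ v ++ u))         ≡⟨ cong (λ t → trace (monodromy (1 ∷ t))) vu≡ ⟩
        trace (monodromy (1 ∷ u′ ∷ʳ suc e))    ≡⟨ trace-cut eq ⟩
        trace (monodromy (b ∷ w′))             ∎)) hyp)
        where open ≡-Reasoning

-- Infinite friezes

module Frieze (F : InfiniteFrieze) where
  open InfiniteFrieze F

  -- Comparing the two diamonds that share the entry m (i + 1) j transports the
  -- recurrence from row i + 1 to row i.
  recurrence : ∀ d i j → j ≡ i - 1ℤ + + d →
               m i (j + 1ℤ) + m i (j - 1ℤ) ≡ m (j + 1ℤ) (j + 1ℤ) * m i j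
  recurrence zero i j refl = begin
    m i (j + 1ℤ) + m i (j - 1ℤ)    ≡⟨ cong₂ (λ x y → m i x + m i y) (j+1≡i i) (j-1≡i-2 i) ⟩
    m i i + m i (i - + 2)          ≡⟨ cong (_+_ (m i i)) (zeros i) ⟩
    m i i + 0ℤ                     ≡⟨ regroup (m i i) ⟩
    m i i * 1ℤ                     ≡⟨ cong₂ (λ x y → m x x * y) (j+1≡i i)
                                        (trans (cong (m i) (ℤₚ.+-identityʳ _)) (ones i)) ⟨
    m (j + 1ℤ) (j + 1ℤ) * m i j    ∎
    where
    open ≡-Reasoning
    j+1≡i : ∀ i → i - 1ℤ + 0ℤ + 1ℤ ≡ i
    j+1≡i = solve-∀
    j-1≡i-2 : ∀ i → i - 1ℤ + 0ℤ - 1ℤ ≡ i - (1ℤ + 1ℤ)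
    j-1≡i-2 = solve-∀
    regroup : ∀ x → x + 0ℤ ≡ x * 1ℤ
    regroup = solve-∀
  recurrence (suc d) i j j≡ =
    ℤₚ.*-cancelʳ-≡ _ _ p ⦃ ℤ.>-nonZero p>0 ⦄ (begin
      (X + Y) * p                                  ≡⟨ expand X Y p x u v ⟩
      x * (u + v) - (x * u - X * p) + (Y * p - x * v)
        ≡⟨ cong₂ (λ s t → x * (u + v) - s + t) (diamond i j i-1≤j) lower ⟩
      x * (u + v) - 1ℤ + 1ℤ
        ≡⟨ cong (λ s → x * s - 1ℤ + 1ℤ) (recurrence d (i + 1ℤ) j j≡′) ⟩
      x * (A * p) - 1ℤ + 1ℤ                        ≡⟨ collect x A p ⟩
      A * x * p                                    ∎)
    where
    open ≡-Reasoning
    x = m i j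
    X = m i (j + 1ℤ)
    Y = m i (j - 1ℤ)
    p = m (i + 1ℤ) j
    u = m (i + 1ℤ) (j + 1ℤ)
    v = m (i + 1ℤ) (j - 1ℤ)
    A = m (j + 1ℤ) (j + 1ℤ)
    j≡′ : j ≡ i + 1ℤ - 1ℤ + + d
    j≡′ = trans j≡ (regroup i (+ d))
      where
      regroup : ∀ i d → i - 1ℤ + (1ℤ + d) ≡ i + 1ℤ - 1ℤ + d
      regroup = solve-∀
    i≤j : i + 1ℤ - 1ℤ ≤ j
    i≤j = subst (i + 1ℤ - 1ℤ ≤_) (sym j≡′) (ℤₚ.i≤i+j _ (+ d))
    i-1≤j : i - 1ℤ ≤ j
    i-1≤j = subst (i - 1ℤ ≤_) (sym j≡) (ℤₚ.i≤i+j _ (+ suc d))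
    p>0 : 0ℤ < p
    p>0 = positive (i + 1ℤ) j i≤j
    i-1≤j-1 : i - 1ℤ ≤ j - 1ℤ
    i-1≤j-1 = subst (_≤ j - 1ℤ) (undo i) (ℤₚ.+-monoˡ-≤ -1ℤ i≤j)
      where
      undo : ∀ i → i + 1ℤ - 1ℤ - 1ℤ ≡ i - 1ℤ
      undo = solve-∀
    lower : Y * p - x * v ≡ 1ℤ
    lower = subst (λ k → Y * m (i + 1ℤ) k - m i k * v ≡ 1ℤ) (undo j) (diamond i (j - 1ℤ) i-1≤j-1)
      where
      undo : ∀ j → j - 1ℤ + 1ℤ ≡ j
      undo = solve-∀
    expand : ∀ X Y p x u v → (X + Y) * p ≡ x * (u + v) - (x * u - X * p) + (Y * p - x * v)
    expand = solve-∀
    collect : ∀ x A p → x * (A * p) - 1ℤ + 1ℤ ≡ A * x * p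
    collect = solve-∀

  quiddity : ℕ → ℕ
  quiddity r = ℤ.∣ m (+ suc r) (+ suc r) ∣

  +quiddity : ∀ r → + quiddity r ≡ m (+ suc r) (+ suc r)
  +quiddity r = ℤₚ.0≤i⇒+∣i∣≡i (ℤₚ.<⇒≤ (positive _ _ (ℤₚ.i≤j⇒i-k≤j 1ℤ ℤₚ.≤-refl)))

  recurrence-ℕ : ∀ {i j} d → + j ≡ i - 1ℤ + + d →
                 m i (+ suc j) + m i (+ j - 1ℤ) ≡ + quiddity j * m i (+ j)
  recurrence-ℕ {i} {j} d eq = trans
    (subst (λ k → m i k + m i (+ j - 1ℤ) ≡ m k k * m i (+ j)) (ℤₚ.+-comm (+ j) 1ℤ)
           (recurrence d i (+ j) eq))
    (cong (_* m i (+ j)) (sym (+quiddity j)))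

  -- Right multiplication by `step x` sends a matrix row `(p , - q)` to `(x p - q , - p)`. By the
  -- recurrence the two matrix rows therefore advance along the rows 1 and 2 of the frieze, and the
  -- trace is the difference that defines a growth coefficient.
  monodromy-quiddity : ∀ n → monodromy (applyUpTo quiddity (suc n)) ≡
    mat (m 1ℤ (+ suc n)) (- m 1ℤ (+ n)) (m (+ 2) (+ suc n)) (- m (+ 2) (+ n))
  monodromy-quiddity zero = mat-cong
    (trans (e₁ (+ quiddity 0)) (+quiddity 0)) (trans (e₂ (+ quiddity 0)) (cong -_ (sym (ones 1ℤ))))
    (sym (ones (+ 2))) (cong -_ (sym (zeros (+ 2))))
    where
    e₁ : ∀ x → x * 1ℤ + -1ℤ * 0ℤ ≡ x
    e₁ = solve-∀
    e₂ : ∀ x → x * 0ℤ + -1ℤ * 1ℤ ≡ - 1ℤ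
    e₂ = solve-∀
  monodromy-quiddity (suc n) = begin
    monodromy (applyUpTo quiddity (suc (suc n)))
      ≡⟨ cong monodromy (applyUpTo-∷ʳ quiddity (suc n)) ⟨
    monodromy (applyUpTo quiddity (suc n) ∷ʳ x)
      ≡⟨ monodromy-++ (applyUpTo quiddity (suc n)) (x ∷ []) ⟩
    monodromy (applyUpTo quiddity (suc n)) ⊗ monodromy (x ∷ [])
      ≡⟨ cong (_⊗ monodromy (x ∷ [])) (monodromy-quiddity n) ⟩
    mat (m 1ℤ (+ suc n)) (- m 1ℤ (+ n)) (m (+ 2) (+ suc n)) (- m (+ 2) (+ n)) ⊗ monodromy (x ∷ [])
      ≡⟨ mat-cong (advance {1ℤ} (suc n) refl) (e₂ (m 1ℤ (+ suc n)) (m 1ℤ (+ n)) (+ x))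
                  (advance {+ 2} n refl) (e₂ (m (+ 2) (+ suc n)) (m (+ 2) (+ n)) (+ x)) ⟩
    mat (m 1ℤ (+ suc (suc n))) (- m 1ℤ (+ suc n)) (m (+ 2) (+ suc (suc n))) (- m (+ 2) (+ suc n)) ∎
    where
    open ≡-Reasoning
    x = quiddity (suc n)
    e₁ : ∀ a b x → a * (x * 1ℤ + -1ℤ * 0ℤ) + - b * (1ℤ * 1ℤ + 0ℤ * 0ℤ) ≡ x * a - b
    e₁ = solve-∀
    e₂ : ∀ a b x → a * (x * 0ℤ + -1ℤ * 1ℤ) + - b * (1ℤ * 0ℤ + 0ℤ * 1ℤ) ≡ - a
    e₂ = solve-∀
    undo : ∀ a b → a + b - b ≡ a
    undo = solve-∀
    advance : ∀ {i} d → + suc n ≡ i - 1ℤ + + d →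
      m i (+ suc n) * (+ x * 1ℤ + -1ℤ * 0ℤ) + - m i (+ n) * (1ℤ * 1ℤ + 0ℤ * 0ℤ) ≡
      m i (+ suc (suc n))
    advance {i} d eq = begin
      m i (+ suc n) * (+ x * 1ℤ + -1ℤ * 0ℤ) + - m i (+ n) * (1ℤ * 1ℤ + 0ℤ * 0ℤ)
        ≡⟨ e₁ (m i (+ suc n)) (m i (+ n)) (+ x) ⟩
      + x * m i (+ suc n) - m i (+ n)                 ≡⟨ cong (_- m i (+ n)) (recurrence-ℕ d eq) ⟨
      m i (+ suc (suc n)) + m i (+ n) - m i (+ n)     ≡⟨ undo _ _ ⟩
      m i (+ suc (suc n))                             ∎

  -- The recurrence whose first coefficient is `quiddity 0`, that is a₁, starts from the entries in
  -- columns -1 and 0. In row 1 the former is the boundary zero; row 0 has the entry 1 there, and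
  -- only positive entries after it.
  row : ℕ → ℕ
  row j = ℤ.∣ m 0ℤ (+ j - 1ℤ) ∣

  row-positive : ∀ j → 0ℤ < m 0ℤ (+ j - 1ℤ)
  row-positive j = positive 0ℤ (+ j - 1ℤ) (ℤₚ.+-monoˡ-≤ -1ℤ {0ℤ} {+ j} (ℤ.+≤+ z≤n))

  +row : ∀ j → + row j ≡ m 0ℤ (+ j - 1ℤ)
  +row j = ℤₚ.0≤i⇒+∣i∣≡i (ℤₚ.<⇒≤ (row-positive j))

  row-recurrence : ∀ j → row j ℕ.+ row (suc (suc j)) ≡ quiddity j ℕ.* row (suc j)
  row-recurrence j = ℤₚ.+-injective (begin
    + row j + + row (suc (suc j))          ≡⟨ ℤₚ.+-comm (+ row j) (+ row (suc (suc j))) ⟩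
    + row (suc (suc j)) + + row j          ≡⟨ cong₂ _+_ (+row (suc (suc j))) (+row j) ⟩
    m 0ℤ (+ suc j) + m 0ℤ (+ j - 1ℤ)       ≡⟨ recurrence-ℕ (suc j) refl ⟩
    + quiddity j * m 0ℤ (+ j)              ≡⟨ cong (+ quiddity j *_) (+row (suc j)) ⟨
    + quiddity j * + row (suc j)           ≡⟨ ℤₚ.pos-* (quiddity j) _ ⟨
    + (quiddity j ℕ.* row (suc j))         ∎)
    where open ≡-Reasoning

  module _ (N : ℕ) (diagonal-period : ∀ x → m (x + + N) (x + + N) ≡ m x x) where

    diagonal-shift : ∀ t x → m (x + t * + N) (x + t * + N) ≡ m x x
    diagonal-shift = periodic-shift (λ x → m x x) N diagonal-period

    LongRun-quiddity : LongRun (applyUpTo quiddity N)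
    LongRun-quiddity = (λ k → row (k ℕ.* N)) , (λ k → row (suc (k ℕ.* N))) , λ k →
      subst (λ w → Run w (row (k ℕ.* N)) (row (suc (k ℕ.* N)))
                         (row (suc k ℕ.* N)) (row (suc (suc k ℕ.* N))))
            (applyUpTo-cong N (λ {j} _ → quiddity-shift k j))
            (Run-applyUpTo (λ j → row (j ℕ.+ k ℕ.* N)) (λ j → quiddity (j ℕ.+ k ℕ.* N))
                           (λ j → ∣positive∣ (row-positive (j ℕ.+ k ℕ.* N)))
                           (λ j → row-recurrence (j ℕ.+ k ℕ.* N)) N)
      where
      ∣positive∣ : ∀ {i} → 0ℤ < i → 0 ℕ.< ℤ.∣ i ∣
      ∣positive∣ (ℤ.+<+ 0<n) = 0<n
      quiddity-shift : ∀ k j → quiddity (j ℕ.+ k ℕ.* N) ≡ quiddity j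
      quiddity-shift k j = cong ℤ.∣_∣ (trans
        (cong (λ x → m x x) (cong (_+_ (+ suc j)) (ℤₚ.pos-* k N)))
        (diagonal-shift (+ k) (+ suc j)))

  DiscSequence-realisable : ∀ n → (∀ x → m (x + + suc n) (x + + suc n) ≡ m x x) →
    DiscSequence (suc n) (applyUpTo quiddity (suc n)) → RealisableInPuncturedDisc F
  DiscSequence-realisable n period (T , c , eq) =
    -- The label `c + r` carries the entry of index `r + 1`, so the label `k` carries the entry of
    -- index `1 - c + k`.
    N , s≤s z≤n , T , tt , s≤s z≤n , 1ℤ - c , λ t k → agrees t (toℕ k)
    where
    open ≡-Reasoning
    N = suc n
    agrees : ∀ t k → let i = 1ℤ - c + + k + t * + N in
             m i i ≡ + regionsAt (puncturedDisc N) T tt (+ k)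
    agrees t k = begin
      m i i                                                ≡⟨ cong (λ x → m x x) i≡ ⟩
      m (+ suc r + (q + t) * + N) (+ suc r + (q + t) * + N)
        ≡⟨ diagonal-shift N period (q + t) (+ suc r) ⟩
      m (+ suc r) (+ suc r)                                ≡⟨ +quiddity r ⟨
      + quiddity r
        ≡⟨ cong +_ (applyUpTo-injective quiddity (λ r → regions (c + + r)) eq (n%ℕd<d z N)) ⟩
      + regions (c + + r)
        ≡⟨ cong +_ (periodic-shift regions N (regionsAt-periodic N T) q (c + + r)) ⟨
      + regions (c + + r + q * + N)                        ≡⟨ cong (λ x → + regions x) k≡ ⟨
      + regions (+ k)                                      ∎
      where
      regions = regionsAt (puncturedDisc N) T tt
      i = 1ℤ - c + + k + t * + N
      z = + k - c
      r = z %ℕ N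
      q = z /ℕ N
      z≡ : z ≡ + r + q * + N
      z≡ = a≡a%ℕn+[a/ℕn]*n z N
      i≡ : i ≡ + suc r + (q + t) * + N
      i≡ = trans (front (+ k) c (t * + N))
        (trans (cong (λ y → 1ℤ + y + t * + N) z≡) (back (+ r) q t (+ N)))
        where
        front : ∀ k c s → 1ℤ - c + k + s ≡ 1ℤ + (k - c) + s
        front = solve-∀
        back : ∀ r q t N → 1ℤ + (r + q * N) + t * N ≡ 1ℤ + r + (q + t) * N
        back = solve-∀
      k≡ : + k ≡ c + + r + q * + N
      k≡ = trans (restore (+ k) c) (trans (cong (_+_ c) z≡) (sym (ℤₚ.+-assoc c (+ r) _)))
        where
        restore : ∀ k c → k ≡ c + (k - c)
        restore = solve-∀

corollary3p8 : (F : InfiniteFrieze) (n : ℕ) → IsMinimalPeriod F n →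
    RealisableInAnnulus F → ¬ RealisableInPuncturedDisc F →
    ∀ (k : ℕ) → 0 ℕ.< k → + 2 < growth F n k
corollary3p8 F (suc n) (_ , period , _) _ ¬disc (suc k) _ =
  case disc-or-hyperbolic p (applyUpTo quiddity N) (length-applyUpTo quiddity N)
         (LongRun-quiddity N diagonal-period) of λ where
    (inj₁ disc) → ⊥-elim (¬disc (DiscSequence-realisable p diagonal-period disc))
    (inj₂ hyp)  → subst (+ 2 <_) (cong trace (monodromy-quiddity p)) hyp
  where
  open InfiniteFrieze F
  open Frieze F
  p N : ℕ
  -- Chosen so that `suc p` computes to `suc k * suc n`; the trace given by `monodromy-quiddity p`
  -- is then the growth coefficient by computation.
  p = n ℕ.+ k ℕ.* suc n
  N = suc p
  diagonal-period : ∀ x → m (x + + N) (x + + N) ≡ m x x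
  diagonal-period x = trans (cong (λ s → m (x + s) (x + s)) (ℤₚ.pos-* (suc k) (suc n)))
    (periodic-shift (λ x → m x x) (suc n)
      (λ x → period x x (ℤₚ.i≤j⇒i-k≤j (+ 2) ℤₚ.≤-refl)) (+ suc k) x)
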